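{- For every fixed $\epsilon\in(0,1)$, every $n$-vertex weighted undirected graph $G=(V,E)$ and every set $P\subseteq V\times V$ of $p$ pairs, one can compute a $(1+\epsilon)$-preserver for $P$ with $n^{o(1)}\cdot(n+p)$ edges.
   Context: Edge weights are positive and polynomially bounded in $n$. The $o(1)$ term tends to $0$ as $n\to\infty$ (for fixed $\epsilon$), uniformly over graphs and pair sets. A $(1+\epsilon)$-preserver for $P$ is a subgraph $G^*\subseteq G$ with $\mathrm{dist}_{G^*}(u,v)\le(1+\epsilon)\,\mathrm{dist}_G(u,v)$ for every $(u,v)\in P$.
   Formalization: The edge weights of the graph and the parameter ε are taken to be rational numbers rather than real numbers. -}

module Defs where

open import Data.Bool.Base using (T)
open import Data.Fin.Base using (Fin)
import Data.Fin.Properties as Fin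
open import Data.Integer.Base using (+_; -[1+_])
open import Data.List.Base using (List; length; filter; cartesianProduct; allFin)
open import Data.List.Membership.Propositional using (_∈_)
open import Data.Maybe.Base as Maybe using (Maybe; just; nothing; is-just)
open import Data.Nat.Base as ℕ using (ℕ; suc)
open import Data.Product.Base using (_×_; _,_; ∃-syntax)
open import Data.Rational.Base using (ℚ; 0ℚ; 1ℚ; _+_; _*_; _/_; ∣_∣; _≤_; _<_; ↥_; ↧ₙ_)
open import Relation.Binary.Construct.Add.Supremum.NonStrict _≤_ using (_≤⁺_)
open import Relation.Binary.PropositionalEquality using (_≡_)
open import Relation.Nullary.Construct.Add.Supremum using (_⁺; ⊤⁺; [_])
open import Relation.Nullary.Decidable using (_×-dec_; T?)
open import Relation.Nullary.Negation using (¬_)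

-- Simple undirected graphs on the vertex set Fin n:
-- weight u v ≡ just w means that uv is an edge of weight w.
record WeightedGraph (n : ℕ) : Set where
  field
    weight      : Fin n → Fin n → Maybe ℚ
    symmetric   : ∀ u v → weight u v ≡ weight v u
    irreflexive : ∀ u → weight u u ≡ nothing
    positive    : ∀ {u v w} → weight u v ≡ just w → 0ℚ < w

open WeightedGraph public

-- Each undirected edge is listed once, with its smaller endpoint first.
edges : ∀ {n} → WeightedGraph n → List (Fin n × Fin n)
edges {n} G =
  filter (λ (u , v) → (u Fin.<? v) ×-dec T? (is-just (weight G u v)))
         (cartesianProduct (allFin n) (allFin n))

∣E_∣ : ∀ {n} → WeightedGraph n → ℕ
∣E G ∣ = length (edges G)

-- Subgraphs keep all the vertices; retained edges keep their weights.
infix 4 _⊆_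
_⊆_ : ∀ {n} → WeightedGraph n → WeightedGraph n → Set
H ⊆ G = ∀ {u v w} → weight H u v ≡ just w → weight G u v ≡ just w

WeightsAtMost : ∀ {n} → ℕ → WeightedGraph n → Set
WeightsAtMost B G = ∀ {u v w} → weight G u v ≡ just w → w ≤ + B / 1

data Walk {n} (G : WeightedGraph n) : Fin n → Fin n → Set where
  done : ∀ {u} → Walk G u u
  step : ∀ {u x v w} → weight G u x ≡ just w → Walk G x v → Walk G u v

walkLength : ∀ {n} {G : WeightedGraph n} {u v} → Walk G u v → ℚ
walkLength done                = 0ℚ
walkLength (step {w = w} _ π) = w + walkLength π

-- IsDist G u v d: the distance from u to v in G is d, where ⊤⁺ plays the role
-- of ∞.
data IsDist {n} (G : WeightedGraph n) (u v : Fin n) : ℚ ⁺ → Set where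
  finite   : (π : Walk G u v) → (∀ (ρ : Walk G u v) → walkLength π ≤ walkLength ρ) →
             IsDist G u v [ walkLength π ]
  infinite : ¬ Walk G u v → IsDist G u v ⊤⁺

-- Multiplication by a positive rational c, with c · ∞ = ∞.
infixr 7 _·⁺_
_·⁺_ : ℚ → ℚ ⁺ → ℚ ⁺
c ·⁺ d = Maybe.map (c *_) d

-- H is a (1 + ε)-preserver of G for the pairs P.
record IsPreserver {n} (ε : ℚ) (G : WeightedGraph n) (P : List (Fin n × Fin n))
                   (H : WeightedGraph n) : Set where
  field
    subgraph : H ⊆ G
    stretch  : ∀ {u v} → (u , v) ∈ P → ∀ {d} → IsDist G u v d →
               ∃[ d* ] IsDist H u v d* × d* ≤⁺ (1ℚ + ε) ·⁺ d

-- m ≤ n ^ q · s for a rational exponent q = a / b (b ≥ 1), with both sides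
-- raised to the power b and a negative power of n moved to the left.
infix 4 _≤_^_·_
_≤_^_·_ : ℕ → ℕ → ℚ → ℕ → Set
m ≤ n ^ q · s with ↥ q
... | + a      = m ℕ.^ ↧ₙ q ℕ.≤ n ℕ.^ a ℕ.* s ℕ.^ ↧ₙ q
... | -[1+ a ] = m ℕ.^ ↧ₙ q ℕ.* n ℕ.^ suc a ℕ.≤ s ℕ.^ ↧ₙ q

TendsToZero : (ℕ → ℚ) → Set
TendsToZero o = ∀ δ → 0ℚ < δ → ∃[ N ] ∀ n → N ℕ.≤ n → ∣ o n ∣ < δ

{-# OPTIONS --safe #-}

-- The preserver is read off a deterministic Thorup–Zwick hierarchy
-- V = A₀ ⊇ A₁ ⊇ … of nets, each smaller than the one before by a factor of
-- s ≈ n^(1/2j), in which every vertex x has at most s points u of Aᵢ with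
-- 3 d(x,u) < d(x,Aᵢ₊₁).  The shortest-path trees towards these points and
-- towards the nearest points of the Aᵢ have O(j n s) edges in total.  By
-- induction on i, a pair x, y is either joined by a (1 + O(iθ))-approximate
-- path with boundedly many edges outside the trees, or x is within 4 d(x,y) of
-- Aᵢ₊₁: cut a shortest path into 1/θ pieces, follow it from both ends up to the
-- first piece that fails, climb to Aᵢ₊₁ at these two places, and join the two
-- net points by a tree path; if there is none, then Aᵢ₊₂ is near.  Since A₂ⱼ is
-- empty, the first alternative holds for i = 2j - 1.  For fixed j the size is
-- O(n^(1/2j) (n + p)), hence at most n^(1/j) (n + p) once n exceeds some
-- threshold T(j), and j may grow with n as slowly as T requires.
module Submission where

open import Defs
open import Data.Empty using (⊥; ⊥-elim)
open import Data.Fin.Base using (Fin)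
open import Data.Fin.Induction using (spo-wellFounded)
import Data.Fin.Properties as Fin
open import Data.Integer.Base as ℤ using () renaming (+_ to pos)
import Data.Integer.Properties as ℤ
import Data.Integer.Solver as ℤ
open import Data.List.Base
  using (List; []; _∷_; _++_; length; filter; map; concat; concatMap; cartesianProduct; allFin; upTo)
open import Data.List.Membership.DecPropositional using () renaming (_∈?_ to member?)
open import Data.List.Membership.Propositional using (_∈_; find; lose)
open import Data.List.Membership.Propositional.Properties
  using (∈-allFin; ∈-map⁺; ∈-cartesianProduct⁺; ∈-∃++; ∈-++⁺ˡ; ∈-++⁺ʳ; ∈-++⁻; ∈-filter⁺; ∈-filter⁻;
         ∈-concatMap⁺; ∈-upTo⁺; ∈-length)
import Data.List.Properties as List
open import Data.List.Relation.Binary.Permutation.Propositional using (_↭_; ↭-sym; ↭⇒↭ₛ)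
open import Data.List.Relation.Binary.Permutation.Propositional.Properties using (∈-resp-↭; ↭-length)
import Data.List.Relation.Binary.Permutation.Setoid.Properties as Permutationₛ
open import Data.List.Relation.Binary.Subset.Propositional using () renaming (_⊆_ to _⊆ₗ_)
open import Data.List.Relation.Unary.All as All using (All; []; _∷_; all?)
import Data.List.Relation.Unary.All.Properties as All
open import Data.List.Relation.Unary.AllPairs as AllPairs using (AllPairs; []; _∷_)
import Data.List.Relation.Unary.AllPairs.Properties as AllPairs
open import Data.List.Relation.Unary.Any using (Any; here; there; any?)
import Data.List.Relation.Unary.Sorted.TotalOrder.Properties as Sorted
open import Data.List.Relation.Unary.Unique.Propositional using (Unique)
import Data.List.Relation.Unary.Unique.Propositional.Properties as Unique
import Data.List.Sort as Sort
open import Data.Maybe.Base using (Maybe; just; nothing)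
open import Data.Nat.Base as ℕ using (ℕ; zero; suc; _^_; z≤n; s≤s)
import Data.Nat.Coprimality as Coprime
import Data.Nat.Properties as ℕ
open import Data.Nat.Tactic.RingSolver using (solve-∀)
open import Data.Product.Base using (_×_; _,_; ∃-syntax; Σ-syntax; proj₁; proj₂; uncurry; swap)
open import Data.Product.Properties using () renaming (≡-dec to ×-≡-dec)
open import Data.Rational.Base as ℚ
  using (ℚ; mkℚ; 0ℚ; 1ℚ; _<_; _≤_; _+_; _*_; -_; nonNegative; toℚᵘ; ↥_; ↧_)
open import Data.Rational.Properties as ℚ using (≤-refl; ≤-trans; ≤-reflexive; +-mono-≤)
open import Data.Rational.Solver using (module +-*-Solver)
import Data.Rational.Unnormalised.Base as ℚᵘ
import Data.Rational.Unnormalised.Properties as ℚᵘ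
open import Data.Sum.Base as Sum using (_⊎_; inj₁; inj₂)
open import Function.Base using (_∘_; id)
open import Induction.WellFounded using (Acc; acc)
open import Relation.Binary.Bundles using (DecTotalOrder)
import Relation.Binary.Construct.On as On
open import Relation.Binary.PropositionalEquality
  using (_≡_; refl; sym; trans; cong; cong₂; subst; setoid)
open import Relation.Nullary.Construct.Add.Supremum using ([_])
open import Relation.Nullary.Decidable using (Dec; yes; no; _⊎-dec_)
open import Relation.Nullary.Negation using (¬_)

open import Data.List.Extrema (DecTotalOrder.totalOrder ℚ.≤-decTotalOrder)
  using (max; ⊥≤max; xs≤max; argmin; f[argmin]≤f[⊤]; f[argmin]≤f[xs]; argmin-sel)
open import Relation.Binary.Construct.Add.Supremum.NonStrict _≤_ using (_≤⁺_; [_]; _≤⊤⁺)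
open +-*-Solver using (solve; _:=_; _:+_; _:*_; :-_; con)

-- Linear arithmetic: add up hypotheses to x ≤ y and check b - a ≡ y - x.
abstract
  linear-≤ : ∀ {a b x y} → x ≤ y → b + x ≡ a + y → a ≤ b
  linear-≤ x≤y eq = ℚ.≮⇒≥ λ b<a → ℚ.<-irrefl eq (ℚ.+-mono-<-≤ b<a x≤y)

  linear-< : ∀ {a b x y} → x < y → b + x ≡ a + y → a < b
  linear-< x<y eq = ℚ.≰⇒> λ b≤a → ℚ.<-irrefl eq (ℚ.+-mono-≤-< b≤a x<y)

-- Walks and their lengths

private variable
  n : ℕ
  G H : WeightedGraph n
  u v x : Fin n

infixr 5 _∙_
_∙_ : Walk G u x → Walk G x v → Walk G u v
done     ∙ ρ = ρ
step e π ∙ ρ = step e (π ∙ ρ)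

walkLength-∙ : (π : Walk G u x) (ρ : Walk G x v) →
               walkLength (π ∙ ρ) ≡ walkLength π + walkLength ρ
walkLength-∙ done ρ = sym (ℚ.+-identityˡ _)
walkLength-∙ (step {w = w} e π) ρ =
  trans (cong (w +_) (walkLength-∙ π ρ)) (sym (ℚ.+-assoc w _ _))

edge : ∀ {w} → weight G u v ≡ just w → Walk G u v
edge e = step e done

reverse : Walk G u v → Walk G v u
reverse done = done
reverse {G = G} (step {u = u} {x = x} e π) = reverse π ∙ edge (trans (symmetric G x u) e)

walkLength-reverse : (π : Walk G u v) → walkLength (reverse π) ≡ walkLength π
walkLength-reverse done = refl
walkLength-reverse {G = G} (step {u = u} {x = x} {w = w} e π) =
  trans (walkLength-∙ (reverse π) _)
    (trans (cong₂ _+_ (walkLength-reverse π) (ℚ.+-identityʳ w)) (ℚ.+-comm _ w))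

walkLength-nonneg : (π : Walk G u v) → 0ℚ ≤ walkLength π
walkLength-nonneg done = ≤-refl
walkLength-nonneg {G = G} (step e π) =
  +-mono-≤ (ℚ.<⇒≤ (positive G e)) (walkLength-nonneg π)

embed : H ⊆ G → Walk H u v → Walk G u v
embed H⊆G done       = done
embed H⊆G (step e π) = step (H⊆G e) (embed H⊆G π)

walkLength-embed : (H⊆G : H ⊆ G) (π : Walk H u v) →
                   walkLength (embed {H = H} {G = G} H⊆G π) ≡ walkLength π
walkLength-embed H⊆G done                 = refl
walkLength-embed H⊆G (step {w = w} e π) = cong (w +_) (walkLength-embed H⊆G π)

-- Shortest walks, by the Floyd–Warshall algorithm

-- A missing walk counts as infinitely long. Stating upper bounds on lengths in this way avoids
-- arithmetic on extended rationals.
infix 4 _≼_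
_≼_ : Maybe (Walk G u v) → ℚ → Set
just π  ≼ ℓ = walkLength π ≤ ℓ
nothing ≼ ℓ = ⊥

≼-mono : ∀ (p : Maybe (Walk G u v)) {a b} → p ≼ a → a ≤ b → p ≼ b
≼-mono (just π) = ≤-trans

≼-nonneg : ∀ (p : Maybe (Walk G u v)) {a} → p ≼ a → 0ℚ ≤ a
≼-nonneg (just π) = ≤-trans (walkLength-nonneg π)

shorter : Maybe (Walk G u v) → Maybe (Walk G u v) → Maybe (Walk G u v)
shorter nothing  q        = q
shorter (just π) nothing  = just π
shorter (just π) (just ρ) with walkLength π ℚ.≤? walkLength ρ
... | yes _ = just π
... | no  _ = just ρ

shorterˡ : ∀ (p q : Maybe (Walk G u v)) {a} → p ≼ a → shorter p q ≼ a
shorterˡ (just π) nothing  h = h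
shorterˡ (just π) (just ρ) h with walkLength π ℚ.≤? walkLength ρ
... | yes _ = h
... | no  p = ≤-trans (ℚ.<⇒≤ (ℚ.≰⇒> p)) h

shorterʳ : ∀ (p q : Maybe (Walk G u v)) {a} → q ≼ a → shorter p q ≼ a
shorterʳ nothing  q        h = h
shorterʳ (just π) (just ρ) h with walkLength π ℚ.≤? walkLength ρ
... | yes p = ≤-trans p h
... | no  _ = h

shorter⁻ : ∀ (p q : Maybe (Walk G u v)) {a} → shorter p q ≼ a → p ≼ a ⊎ q ≼ a
shorter⁻ nothing  q        h = inj₂ h
shorter⁻ (just π) nothing  h = inj₁ h
shorter⁻ (just π) (just ρ) h with walkLength π ℚ.≤? walkLength ρ
... | yes _ = inj₁ h
... | no  _ = inj₂ h

join : Maybe (Walk G u x) → Maybe (Walk G x v) → Maybe (Walk G u v)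
join (just π) (just ρ) = just (π ∙ ρ)
join _        _        = nothing

join⁺ : ∀ (p : Maybe (Walk G u x)) (q : Maybe (Walk G x v)) {a b} →
        p ≼ a → q ≼ b → join p q ≼ a + b
join⁺ (just π) (just ρ) h k = ≤-trans (≤-reflexive (walkLength-∙ π ρ)) (+-mono-≤ h k)

join⁻ : ∀ (p : Maybe (Walk G u x)) (q : Maybe (Walk G x v)) {c} →
        join p q ≼ c → ∃[ a ] ∃[ b ] p ≼ a × q ≼ b × a + b ≤ c
join⁻ (just π) (just ρ) h =
  _ , _ , ≤-refl , ≤-refl , ≤-trans (≤-reflexive (sym (walkLength-∙ π ρ))) h

module FloydWarshall {n} (G : WeightedGraph n) where

  Table : Set
  Table = ∀ u v → Maybe (Walk G u v)

  oneEdge : ∀ {u v} m → weight G u v ≡ m → Maybe (Walk G u v)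
  oneEdge (just _) e = just (edge e)
  oneEdge nothing  _ = nothing

  initial : Table
  initial u v with u Fin.≟ v
  ... | yes refl = just done
  ... | no  _    = oneEdge _ refl

  relax : Fin n → Table → Table
  relax y σ u v = shorter (σ u v) (join (σ u y) (σ y v))

  through : List (Fin n) → Table
  through []       = initial
  through (y ∷ ys) = relax y (through ys)

  oneEdge-≼ : ∀ {u v w} m (e : weight G u v ≡ m) → weight G u v ≡ just w → oneEdge m e ≼ w
  oneEdge-≼ (just a) e e′ with trans (sym e) e′
  ... | refl = ≤-reflexive (ℚ.+-identityʳ a)
  oneEdge-≼ nothing e e′ with trans (sym e) e′
  ... | ()

  through-refl : ∀ ys u → through ys u u ≼ 0ℚ
  through-refl [] u with u Fin.≟ u
  ... | yes refl = ≤-refl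
  ... | no  u≢u  = ⊥-elim (u≢u refl)
  through-refl (y ∷ ys) u = shorterˡ (through ys u u) _ (through-refl ys u)

  through-edge : ∀ ys {u v w} → weight G u v ≡ just w → through ys u v ≼ w
  through-edge [] {u} {v} e with u Fin.≟ v
  ... | yes refl = ℚ.<⇒≤ (positive G e)
  ... | no  _    = oneEdge-≼ _ refl e
  through-edge (y ∷ ys) {u} {v} e = shorterˡ (through ys u v) _ (through-edge ys e)

  ≼-relax : ∀ σ y u v {a} → σ u v ≼ a → relax y σ u v ≼ a
  ≼-relax σ y u v = shorterˡ (σ u v) _

  ≼-relax-via : ∀ σ y u v {a b c} → σ u y ≼ a → σ y v ≼ b → a + b ≤ c → relax y σ u v ≼ c
  ≼-relax-via σ y u v p q a+b≤c =
    ≼-mono (relax y σ u v) (shorterʳ (σ u v) _ (join⁺ (σ u y) (σ y v) p q)) a+b≤c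

  ≼-relax⁻ : ∀ σ y u v {c} → relax y σ u v ≼ c →
             σ u v ≼ c ⊎ (∃[ a ] ∃[ b ] σ u y ≼ a × σ y v ≼ b × a + b ≤ c)
  ≼-relax⁻ σ y u v p with shorter⁻ (σ u v) _ p
  ... | inj₁ q = inj₁ q
  ... | inj₂ q = inj₂ (join⁻ (σ u y) (σ y v) q)

  -- A detour through `y` on the way to `y` only adds a closed walk at `y`, whose length is
  -- nonnegative. So relaxing at `y` does not improve column `y`, nor, by symmetry, row `y`.
  ≼-relax-to : ∀ σ y u {c} → relax y σ u y ≼ c → σ u y ≼ c
  ≼-relax-to σ y u p with ≼-relax⁻ σ y u y p
  ... | inj₁ q = q
  ... | inj₂ (a , b , q , r , le) = ≼-mono (σ u y) q
    (linear-≤ (+-mono-≤ (≼-nonneg (σ y y) r) le)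
       (solve 3 (λ a b c → c :+ (con 0ℚ :+ (a :+ b)) := a :+ (b :+ c)) refl a b _))

  ≼-relax-from : ∀ σ y v {c} → relax y σ y v ≼ c → σ y v ≼ c
  ≼-relax-from σ y v p with ≼-relax⁻ σ y y v p
  ... | inj₁ q = q
  ... | inj₂ (a , b , q , r , le) = ≼-mono (σ y v) r
    (linear-≤ (+-mono-≤ (≼-nonneg (σ y y) q) le)
       (solve 3 (λ a b c → c :+ (con 0ℚ :+ (a :+ b)) := b :+ (a :+ c)) refl a b _))

  TriangleAt : Table → Fin n → Set
  TriangleAt σ x = ∀ u v {a b} → σ u x ≼ a → σ x v ≼ b → σ u v ≼ a + b

  relax-new : ∀ σ y → TriangleAt (relax y σ) y
  relax-new σ y u v p q =
    ≼-relax-via σ y u v (≼-relax-to σ y u p) (≼-relax-from σ y v q) ≤-refl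

  relax-old : ∀ σ y x → TriangleAt σ x → TriangleAt (relax y σ) x
  relax-old σ y x tri u v {a} {b} p q with ≼-relax⁻ σ y u x p | ≼-relax⁻ σ y x v q
  ... | inj₁ p′ | inj₁ q′ = ≼-relax σ y u v (tri u v p′ q′)
  ... | inj₁ p′ | inj₂ (a₂ , b₂ , q₁ , q₂ , le) =
    ≼-relax-via σ y u v (tri u y p′ q₁) q₂
      (≤-trans (≤-reflexive (ℚ.+-assoc a a₂ b₂)) (ℚ.+-monoʳ-≤ a le))
  ... | inj₂ (a₁ , b₁ , p₁ , p₂ , le) | inj₁ q′ =
    ≼-relax-via σ y u v p₁ (tri y v p₂ q′)
      (≤-trans (≤-reflexive (sym (ℚ.+-assoc a₁ b₁ b))) (ℚ.+-monoˡ-≤ b le))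
  ... | inj₂ (a₁ , b₁ , p₁ , p₂ , le) | inj₂ (a₂ , b₂ , q₁ , q₂ , le′) =
    ≼-relax-via σ y u v p₁ q₂
      (linear-≤ (+-mono-≤ (+-mono-≤ le le′)
                          (+-mono-≤ (≼-nonneg (σ y x) p₂) (≼-nonneg (σ x y) q₁)))
        (solve 6 (λ a b a₁ b₁ a₂ b₂ →
           (a :+ b) :+ (((a₁ :+ b₁) :+ (a₂ :+ b₂)) :+ (con 0ℚ :+ con 0ℚ))
           := (a₁ :+ b₂) :+ ((a :+ b) :+ (b₁ :+ a₂))) refl a b a₁ b₁ a₂ b₂))

  through-triangle : ∀ ys {x} → x ∈ ys → TriangleAt (through ys) x
  through-triangle (y ∷ ys) (here refl) = relax-new (through ys) y
  through-triangle (y ∷ ys) (there x∈)  = relax-old (through ys) y _ (through-triangle ys x∈)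

  table : Table
  table = through (allFin n)

  -- Peel off the first edge of `ρ`: its entry is at most its weight, and the triangle inequality
  -- holds at its end, since every vertex has been processed.
  table-shortest : ∀ {u v} (ρ : Walk G u v) → table u v ≼ walkLength ρ
  table-shortest {u} done = through-refl (allFin n) u
  table-shortest {u} {v} (step {x = x} e ρ) =
    through-triangle (allFin n) (∈-allFin x) u v (through-edge (allFin n) e) (table-shortest ρ)

data Shortest {n} (G : WeightedGraph n) (u v : Fin n) : Set where
  reachable   : (π : Walk G u v) → (∀ ρ → walkLength π ≤ walkLength {G = G} {u} {v} ρ) →
                Shortest G u v
  unreachable : ¬ Walk G u v → Shortest G u v

abstract
  shortest : ∀ {n} (G : WeightedGraph n) u v → Shortest G u v
  shortest G u v with FloydWarshall.table G u v | FloydWarshall.table-shortest G {u} {v}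
  ... | just π  | least = reachable π least
  ... | nothing | none  = unreachable none

-- The distance function

-- The graph distance, made total by giving unreachable pairs the value far,
-- which is out of reach for every bound that occurs in the stretch analysis.
record Metric {n} (G : WeightedGraph n) : Set where
  field
    dist          : Fin n → Fin n → ℚ
    far           : ℚ
    dist-nonneg   : ∀ u v → 0ℚ ≤ dist u v
    dist-refl     : ∀ u → dist u u ≡ 0ℚ
    dist-sym      : ∀ u v → dist u v ≡ dist v u
    dist-triangle : ∀ u x v → dist u v ≤ dist u x + dist x v
    dist-shortest : ∀ {u v} (π : Walk G u v) → dist u v ≤ walkLength π
    dist-attained : ∀ {u v} → dist u v < far → Σ[ π ∈ Walk G u v ] walkLength π ≡ dist u v
    dist≪far      : ∀ {u v} → Walk G u v →
                    dist u v + dist u v + dist u v + dist u v + dist u v < far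

private
  quintuple : ℚ → ℚ
  quintuple d = d + d + d + d + d

  0≤1 : 0ℚ ≤ 1ℚ
  0≤1 = ℚ.nonNegative⁻¹ 1ℚ

  quintuple<1+quintuple : ∀ d → quintuple d < 1ℚ + quintuple d
  quintuple<1+quintuple d = linear-< (ℚ.positive⁻¹ 1ℚ)
    (solve 1 (λ d → (con 1ℚ :+ d) :+ con 0ℚ := d :+ con 1ℚ) refl (quintuple d))

  ≤1+quintuple : ∀ {d} → 0ℚ ≤ d → d ≤ 1ℚ + quintuple d
  ≤1+quintuple {d} 0≤d = linear-≤ (+-mono-≤ (+-mono-≤ 0≤d 0≤d) (+-mono-≤ (+-mono-≤ 0≤d 0≤d) 0≤1))
    (solve 1 (λ d → (con 1ℚ :+ (d :+ d :+ d :+ d :+ d)) :+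
                    ((con 0ℚ :+ con 0ℚ) :+ ((con 0ℚ :+ con 0ℚ) :+ con 0ℚ))
                    := d :+ ((d :+ d) :+ ((d :+ d) :+ con 1ℚ))) refl d)

module _ {n} (G : WeightedGraph n) where

  private
    lengthOr : ∀ {u v} → ℚ → Shortest G u v → ℚ
    lengthOr c (reachable π _) = walkLength π
    lengthOr c (unreachable _) = c

    abstract
      lengths : List ℚ
      -- Unreachable pairs enter with length 0, which cannot raise the maximum.
      lengths = map (uncurry λ u v → lengthOr 0ℚ (shortest G u v))
                    (cartesianProduct (allFin n) (allFin n))

      diameter : ℚ
      diameter = max 0ℚ lengths

      length≤diameter : ∀ u v → lengthOr 0ℚ (shortest G u v) ≤ diameter
      length≤diameter u v = All.lookup (xs≤max 0ℚ lengths)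
        (∈-map⁺ _ (∈-cartesianProduct⁺ (∈-allFin u) (∈-allFin v)))

      0≤diameter : 0ℚ ≤ diameter
      0≤diameter = ⊥≤max 0ℚ lengths

    -- This value exceeds every finite distance, so it identifies unreachable pairs. No distance
    -- exceeds it either, so the triangle inequality survives when a term on the right is `far`.
    far : ℚ
    far = 1ℚ + quintuple diameter

    diameter≤far : diameter ≤ far
    diameter≤far = ≤1+quintuple 0≤diameter

    0≤far : 0ℚ ≤ far
    0≤far = ≤-trans 0≤diameter diameter≤far

    dist : Fin n → Fin n → ℚ
    dist u v = lengthOr far (shortest G u v)

    data DistView (u v : Fin n) (d : ℚ) : Set where
      near : (π : Walk G u v) → walkLength π ≡ d → d ≤ diameter → DistView u v d
      away : ¬ Walk G u v → d ≡ far → DistView u v d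

    view : ∀ u v → DistView u v (dist u v)
    view u v with shortest G u v | length≤diameter u v
    ... | reachable π _ | bound = near π refl bound
    ... | unreachable ¬π | _    = away ¬π refl

    nonneg : ∀ u v → 0ℚ ≤ dist u v
    nonneg u v with view u v
    ... | near π eq _ = ≤-trans (walkLength-nonneg π) (≤-reflexive eq)
    ... | away _ eq   = ≤-trans 0≤far (≤-reflexive (sym eq))

    ≤far : ∀ u v → dist u v ≤ far
    ≤far u v with view u v
    ... | near _ _ bound = ≤-trans bound diameter≤far
    ... | away _ eq      = ≤-reflexive eq

    shortest-≤ : ∀ {u v} (π : Walk G u v) → dist u v ≤ walkLength π
    shortest-≤ {u} {v} π with shortest G u v
    ... | reachable _ least = least π
    ... | unreachable ¬π    = ⊥-elim (¬π π)

    sym-≤ : ∀ u v → dist v u ≤ dist u v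
    sym-≤ u v with view u v
    ... | near π eq _ = ≤-trans (shortest-≤ (reverse π))
                          (≤-reflexive (trans (walkLength-reverse π) eq))
    ... | away _ eq   = ≤-trans (≤far v u) (≤-reflexive (sym eq))

    triangle : ∀ u x v → dist u v ≤ dist u x + dist x v
    triangle u x v with view u x | view x v
    ... | near π eq _ | near ρ eq′ _ = ≤-trans (shortest-≤ (π ∙ ρ))
      (≤-reflexive (trans (walkLength-∙ π ρ) (cong₂ _+_ eq eq′)))
    ... | away _ eq | _ = ≤-trans (≤far u v) (≤-trans (≤-reflexive (sym (ℚ.+-identityʳ far)))
      (+-mono-≤ (≤-reflexive (sym eq)) (nonneg x v)))
    ... | near _ _ _ | away _ eq = ≤-trans (≤far u v) (≤-trans (≤-reflexive (sym (ℚ.+-identityˡ far)))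
      (+-mono-≤ (nonneg u x) (≤-reflexive (sym eq))))

    attained : ∀ {u v} → dist u v < far → Σ[ π ∈ Walk G u v ] walkLength π ≡ dist u v
    attained {u} {v} d<far with view u v
    ... | near π eq _ = π , eq
    ... | away _ eq   = ⊥-elim (ℚ.<-irrefl eq d<far)

    walk⇒≪far : ∀ {u v} → Walk G u v →
                dist u v + dist u v + dist u v + dist u v + dist u v < far
    walk⇒≪far {u} {v} π with view u v
    ... | near _ _ b = ℚ.≤-<-trans (+-mono-≤ (+-mono-≤ (+-mono-≤ (+-mono-≤ b b) b) b) b)
                                   (quintuple<1+quintuple diameter)
    ... | away ¬π _  = ⊥-elim (¬π π)

  metric : Metric G
  metric = record
    { dist          = dist
    ; far           = far
    ; dist-nonneg   = nonneg
    ; dist-refl     = λ u → ℚ.≤-antisym (shortest-≤ done) (nonneg u u)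
    ; dist-sym      = λ u v → ℚ.≤-antisym (sym-≤ v u) (sym-≤ u v)
    ; dist-triangle = triangle
    ; dist-shortest = shortest-≤
    ; dist-attained = attained
    ; dist≪far      = walk⇒≪far
    }

-- Subgraphs given by lists of edges

unique⊆⇒length≤ : ∀ {A : Set} {xs ys : List A} → Unique xs → xs ⊆ₗ ys → length xs ℕ.≤ length ys
unique⊆⇒length≤ [] _ = z≤n
unique⊆⇒length≤ {xs = x ∷ xs} (x∉xs ∷ uniq) sub with ∈-∃++ (sub (here refl))
... | as , bs , refl = begin
  suc (length xs)                ≤⟨ s≤s (unique⊆⇒length≤ uniq sub′) ⟩
  suc (length (as ++ bs))        ≡⟨ cong suc (List.length-++ as) ⟩
  suc (length as ℕ.+ length bs)  ≡⟨ ℕ.+-suc (length as) (length bs) ⟨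
  length as ℕ.+ suc (length bs)  ≡⟨ List.length-++ as ⟨
  length (as ++ x ∷ bs)          ∎
  where
  open ℕ.≤-Reasoning
  sub′ : xs ⊆ₗ as ++ bs
  sub′ y∈xs with ∈-++⁻ as (sub (there y∈xs))
  ... | inj₁ y∈as         = ∈-++⁺ˡ y∈as
  ... | inj₂ (here refl)  = ⊥-elim (All.lookup x∉xs y∈xs refl)
  ... | inj₂ (there y∈bs) = ∈-++⁺ʳ as y∈bs

length-concatMap-≤ : ∀ {A B : Set} (f : A → List B) {c} xs → (∀ x → length (f x) ℕ.≤ c) →
                     length (concatMap f xs) ℕ.≤ length xs ℕ.* c
length-concatMap-≤ f [] bound = z≤n
length-concatMap-≤ f (x ∷ xs) bound = ℕ.≤-trans (ℕ.≤-reflexive (List.length-++ (f x)))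
  (ℕ.+-mono-≤ (bound x) (length-concatMap-≤ f xs bound))

length-cartesianProduct : ∀ {A B : Set} (xs : List A) (ys : List B) →
                          length (cartesianProduct xs ys) ≡ length xs ℕ.* length ys
length-cartesianProduct []       ys = refl
length-cartesianProduct (x ∷ xs) ys = trans (List.length-++ (map (x ,_) ys))
  (cong₂ ℕ._+_ (List.length-map (x ,_) ys) (length-cartesianProduct xs ys))

module _ {n : ℕ} where

  Listed : List (Fin n × Fin n) → Fin n → Fin n → Set
  Listed L u v = (u , v) ∈ L ⊎ (v , u) ∈ L

  listed? : ∀ L u v → Dec (Listed L u v)
  listed? L u v = (u , v) ∈ₚ? L ⊎-dec (v , u) ∈ₚ? L
    where _∈ₚ?_ = member? (×-≡-dec Fin._≟_ Fin._≟_)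

  restrictWeight : WeightedGraph n → List (Fin n × Fin n) → Fin n → Fin n → Maybe ℚ
  restrictWeight G L u v with listed? L u v
  ... | yes _ = weight G u v
  ... | no  _ = nothing

  restrictWeight-listed : ∀ G L {u v} → Listed L u v → restrictWeight G L u v ≡ weight G u v
  restrictWeight-listed G L {u} {v} l with listed? L u v
  ... | yes _ = refl
  ... | no ¬l = ⊥-elim (¬l l)

  restrictWeight-just : ∀ G L {u v w} → restrictWeight G L u v ≡ just w →
                        Listed L u v × weight G u v ≡ just w
  restrictWeight-just G L {u} {v} eq with listed? L u v
  ... | yes l = l , eq
  restrictWeight-just G L () | no _

  restrictWeight-sym : ∀ G L u v → restrictWeight G L u v ≡ restrictWeight G L v u
  restrictWeight-sym G L u v with listed? L u v
  ... | yes l = trans (symmetric G u v) (sym (restrictWeight-listed G L (Sum.swap l)))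
  ... | no ¬l with listed? L v u
  ...   | yes l = ⊥-elim (¬l (Sum.swap l))
  ...   | no _  = refl

  restrictWeight-irrefl : ∀ G L u → restrictWeight G L u u ≡ nothing
  restrictWeight-irrefl G L u with listed? L u u
  ... | yes _ = irreflexive G u
  ... | no  _ = refl

  edges-unique : ∀ (G : WeightedGraph n) → Unique (edges G)
  edges-unique G = Unique.filter⁺ _ (Unique.cartesianProduct⁺ (Unique.allFin⁺ n) (Unique.allFin⁺ n))

  ∣E∣≤n*n : ∀ (G : WeightedGraph n) → ∣E G ∣ ℕ.≤ n ℕ.* n
  ∣E∣≤n*n G = begin
    ∣E G ∣                                         ≤⟨ List.length-filter _ (cartesianProduct (allFin n) (allFin n)) ⟩
    length (cartesianProduct (allFin n) (allFin n)) ≡⟨ length-cartesianProduct (allFin n) (allFin n) ⟩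
    length (allFin n) ℕ.* length (allFin n)         ≡⟨ cong₂ ℕ._*_ len len ⟩
    n ℕ.* n                                         ∎
    where
    open ℕ.≤-Reasoning
    len = List.length-tabulate {n = n} id

  abstract
    restrict : WeightedGraph n → List (Fin n × Fin n) → WeightedGraph n
    restrict G L = record
      { weight      = restrictWeight G L
      ; symmetric   = restrictWeight-sym G L
      ; irreflexive = restrictWeight-irrefl G L
      ; positive    = λ e → positive G (proj₂ (restrictWeight-just G L e))
      }

    restrict-⊆ : ∀ G L → restrict G L ⊆ G
    restrict-⊆ G L e = proj₂ (restrictWeight-just G L e)

    restrict-edge : ∀ G L {u v w} → (u , v) ∈ L → weight G u v ≡ just w →
                    weight (restrict G L) u v ≡ just w
    restrict-edge G L uv∈L e = trans (restrictWeight-listed G L (inj₁ uv∈L)) e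

    restrict-mono : ∀ G {L L′} → L ⊆ₗ L′ → restrict G L ⊆ restrict G L′
    restrict-mono G {L} {L′} L⊆L′ e with restrictWeight-just G L e
    ... | l , e′ = trans (restrictWeight-listed G L′ (Sum.map L⊆L′ L⊆L′ l)) e′

    -- A listed pair may have either orientation, whereas `edges` puts the smaller endpoint first.
    -- Hence `L` is taken together with its reversal, which doubles the count.
    ∣E-restrict∣≤ : ∀ G L → ∣E restrict G L ∣ ℕ.≤ length L ℕ.+ length L
    ∣E-restrict∣≤ G L = begin
      ∣E restrict G L ∣                 ≤⟨ unique⊆⇒length≤ (edges-unique (restrict G L)) sub ⟩
      length (L ++ map swap L)          ≡⟨ List.length-++ L ⟩
      length L ℕ.+ length (map swap L)  ≡⟨ cong (length L ℕ.+_) (List.length-map swap L) ⟩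
      length L ℕ.+ length L             ∎
      where
      open ℕ.≤-Reasoning
      sub : edges (restrict G L) ⊆ₗ L ++ map swap L
      sub {u , v} uv∈ with ∈-filter⁻ _ {xs = cartesianProduct (allFin n) (allFin n)} uv∈
      ... | _ , _ , t with weight (restrict G L) u v in eq
      ...   | just w with proj₁ (restrictWeight-just G L eq)
      ...     | inj₁ l = ∈-++⁺ˡ l
      ...     | inj₂ l = ∈-++⁺ʳ L (∈-map⁺ swap l)

-- Sparse nets

abstract
  sortBy : ∀ {A : Set} → (A → ℚ) → List A → List A
  sortBy f = Sort.sort (On.decTotalOrder ℚ.≤-decTotalOrder f)

  sortBy-↭ : ∀ {A : Set} (f : A → ℚ) xs → sortBy f xs ↭ xs
  sortBy-↭ f = Sort.sort-↭ (On.decTotalOrder ℚ.≤-decTotalOrder f)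

  sortBy-sorted : ∀ {A : Set} (f : A → ℚ) xs → AllPairs (λ x y → f x ≤ f y) (sortBy f xs)
  sortBy-sorted f xs = Sorted.Sorted⇒AllPairs
    (DecTotalOrder.totalOrder (On.decTotalOrder ℚ.≤-decTotalOrder f))
    (Sort.sort-↗ (On.decTotalOrder ℚ.≤-decTotalOrder f) xs)

concat-map-⊆ : ∀ {A B : Set} (f : A → List B) xs {ys} → (∀ x → f x ⊆ₗ ys) → concat (map f xs) ⊆ₗ ys
concat-map-⊆ f (x ∷ xs) f⊆ y∈ with ∈-++⁻ (f x) y∈
... | inj₁ y∈fx = f⊆ x y∈fx
... | inj₂ y∈xs = concat-map-⊆ f xs f⊆ y∈xs

-- The `s` elements of `xs` with the smallest values of `f`. Ties at the radius are broken
-- arbitrarily, so `within` is non-strict and `complete` strict. The chosen `point` is an arbitrary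
-- member, later used as a net point.
record Ball {A : Set} (f : A → ℚ) (xs : List A) (s : ℕ) : Set where
  field
    members  : List A
    radius   : ℚ
    point    : A
    point∈   : point ∈ members
    size     : length members ≡ s
    subset   : members ⊆ₗ xs
    unique   : Unique members
    within   : ∀ {x} → x ∈ members → f x ≤ radius
    complete : ∀ {x} → x ∈ xs → f x < radius → x ∈ members

-- The ball is an initial segment of the sorted list. The additional element attaining the radius is
-- what bounds the new head in the induction.
sorted-ball : ∀ {A : Set} (f : A → ℚ) {xs} → AllPairs (λ x y → f x ≤ f y) xs → Unique xs →
              ∀ s → s ℕ.< length xs →
              Σ[ B ∈ Ball f xs (suc s) ] ∃[ x ] x ∈ xs × f x ≡ Ball.radius B
sorted-ball f {x ∷ xs} (x≤xs ∷ _) _ zero _ = record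
  { members  = x ∷ []
  ; radius   = f x
  ; point    = x
  ; point∈   = here refl
  ; size     = refl
  ; subset   = λ { (here refl) → here refl }
  ; unique   = [] ∷ []
  ; within   = λ { (here refl) → ≤-refl }
  ; complete = λ { (here refl) _     → here refl
                 ; (there y∈)  fy<fx → ⊥-elim (ℚ.<-irrefl refl (ℚ.<-≤-trans fy<fx (All.lookup x≤xs y∈))) }
  } , x , here refl , refl
sorted-ball f {x ∷ xs} (x≤xs ∷ sorted) (x∉xs ∷ uniq) (suc s) (s≤s s<) with sorted-ball f sorted uniq s s<
... | B , y , y∈xs , fy≡r = record
  { members  = x ∷ B.members
  ; radius   = B.radius
  ; point    = x
  ; point∈   = here refl
  ; size     = cong suc B.size
  ; subset   = λ { (here refl) → here refl ; (there z∈) → there (B.subset z∈) }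
  ; unique   = All.tabulate (λ z∈ → All.lookup x∉xs (B.subset z∈)) ∷ B.unique
  ; within   = λ { (here refl) → ≤-trans (All.lookup x≤xs y∈xs) (≤-reflexive fy≡r)
                 ; (there z∈)  → B.within z∈ }
  ; complete = λ { (here refl) _ → here refl ; (there z∈) fz<r → there (B.complete z∈ fz<r) }
  } , y , there y∈xs , fy≡r
  where module B = Ball B

abstract
  nearest : ∀ {A : Set} (f : A → ℚ) {xs} → Unique xs → ∀ s → s ℕ.< length xs → Ball f xs (suc s)
  nearest f {xs} uniq s s<
    with sorted-ball f (sortBy-sorted f xs)
           (Permutationₛ.Unique-resp-↭ (setoid _) (↭⇒↭ₛ (↭-sym (sortBy-↭ f xs))) uniq)
           s (ℕ.<-≤-trans s< (ℕ.≤-reflexive (sym (↭-length (sortBy-↭ f xs)))))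
  ... | B , _ = record
    { Ball B
    ; subset   = ∈-resp-↭ (sortBy-↭ f xs) ∘ Ball.subset B
    ; complete = Ball.complete B ∘ ∈-resp-↭ (↭-sym (sortBy-↭ f xs))
    }

  -- Since xs is sorted by decreasing r, the recursion visits points by increasing
  -- r and keeps those that meet no point kept before.
  packing : ∀ {A : Set} (r : A → ℚ) {Meets : A → A → Set} → (∀ x y → Dec (Meets x y)) →
            (∀ x → Meets x x) → ∀ {xs} → AllPairs (λ x y → r y ≤ r x) xs →
            ∃[ S ] S ⊆ₗ xs × AllPairs (λ x y → ¬ Meets x y) S ×
                   (∀ {x} → x ∈ xs → ∃[ w ] w ∈ S × r w ≤ r x × Meets x w)
  packing r meets? meets-refl [] = [] , (λ ()) , [] , λ ()
  packing r meets? meets-refl {x ∷ xs} (xs≤x ∷ sorted)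
    with packing r meets? meets-refl sorted
  ... | S , S⊆xs , apart , covers with any? (meets? x) S
  ...   | yes meets = S , there ∘ S⊆xs , apart , λ where
          (here refl) → let w , w∈S , m = find meets in w , w∈S , All.lookup xs≤x (S⊆xs w∈S) , m
          (there y∈)  → covers y∈
  ...   | no ¬meets = x ∷ S , (λ { (here refl) → here refl ; (there y∈) → there (S⊆xs y∈) }) ,
          All.¬Any⇒All¬ S ¬meets ∷ apart , λ where
          (here refl) → x , here refl , ≤-refl , meets-refl x
          (there y∈)  → let w , w∈S , rest = covers y∈ in w , there w∈S , rest

neg-cancel-≤ : ∀ {p q} → - p ≤ - q → q ≤ p
neg-cancel-≤ {p} {q} h = linear-≤ h (solve 2 (λ p q → p :+ :- p := q :+ :- q) refl p q)

module Nets {n} {G : WeightedGraph n} (m : Metric G) where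
  open Metric m

  -- Quantifying over `N` expresses a comparison with the distance from `x` to `N`; an empty `N`
  -- counts as infinitely far, and then every `u` qualifies.
  Bunch : List (Fin n) → Fin n → Fin n → Set
  Bunch N x u = All (λ z → dist x u + dist x u + dist x u < dist x z) N

  bunch? : ∀ N x u → Dec (Bunch N x u)
  bunch? N x u = all? (λ z → _ ℚ.<? _) N

  bunch : List (Fin n) → List (Fin n) → Fin n → List (Fin n)
  bunch A N x = filter (bunch? N x) A

  record Net (A : List (Fin n)) (s : ℕ) : Set where
    field
      net        : List (Fin n)
      net-unique : Unique net
      sparse     : length net ℕ.* s ℕ.≤ length A
      few        : ∀ x → length (bunch A net x) ℕ.≤ s

  -- Otherwise `r ≤ d`, and then `e ≤ a + b + c ≤ 3r ≤ 3d`, against `3d < e`.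
  bunch-inside-ball : ∀ {d r r′ a b c e} → r′ ≤ r → e ≤ a + (b + c) →
                      a ≤ r → b ≤ r′ → c ≤ r′ → d + d + d < e → d < r
  bunch-inside-ball {d} {r} r′≤r e≤ a≤r b≤r′ c≤r′ 3d<e = ℚ.≰⇒> λ r≤d →
    ℚ.<-irrefl refl (ℚ.<-≤-trans 3d<e (≤-trans e≤
      (≤-trans (+-mono-≤ (≤-trans a≤r r≤d) (+-mono-≤ (≤-trans b≤r′ (≤-trans r′≤r r≤d))
                                                     (≤-trans c≤r′ (≤-trans r′≤r r≤d))))
               (≤-reflexive (sym (ℚ.+-assoc d d d))))))

  -- With an empty net the bunch of every vertex is all of `A`, which is small enough here.
  trivialNet : ∀ {A s} → length A ℕ.≤ s → Net A s
  trivialNet {A} A≤s = record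
    { net        = []
    ; net-unique = []
    ; sparse     = z≤n
    ; few        = λ x → ℕ.≤-trans (List.length-filter (bunch? [] x) A) A≤s
    }

  module _ {A : List (Fin n)} (A! : Unique A) (s : ℕ) (s<A : s ℕ.< length A) where
    private
      ball : ∀ x → Ball (dist x) A (suc s)
      ball x = nearest (dist x) A! s s<A
      module ball x = Ball (ball x)

      Meets : Fin n → Fin n → Set
      Meets x w = Any (_∈ ball.members w) (ball.members x)

      meets? : ∀ x w → Dec (Meets x w)
      meets? x w = any? (λ u → member? Fin._≟_ u (ball.members w)) (ball.members x)

      meets-refl : ∀ x → Meets x x
      meets-refl x = lose (ball.point∈ x) (ball.point∈ x)

      order : List (Fin n)
      -- Sorting by the negated radius gives the decreasing order that `packing` expects.
      order = sortBy (λ x → - ball.radius x) (allFin n)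

      ∈-order : ∀ x → x ∈ order
      ∈-order x = ∈-resp-↭ (↭-sym (sortBy-↭ _ (allFin n))) (∈-allFin x)

      abstract
        packed : ∃[ S ] S ⊆ₗ order × AllPairs (λ x w → ¬ Meets x w) S ×
                   (∀ {x} → x ∈ order → ∃[ w ] w ∈ S × ball.radius w ≤ ball.radius x × Meets x w)
        packed = packing ball.radius meets? meets-refl
          (AllPairs.map neg-cancel-≤ (sortBy-sorted (λ x → - ball.radius x) (allFin n)))

      centres : List (Fin n)
      centres = proj₁ packed

      centres-apart : AllPairs (λ x w → ¬ Meets x w) centres
      centres-apart = proj₁ (proj₂ (proj₂ packed))

      centres-cover : ∀ {x} → x ∈ order →
                      ∃[ w ] w ∈ centres × ball.radius w ≤ ball.radius x × Meets x w
      centres-cover = proj₂ (proj₂ (proj₂ packed))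

      balls : List (List (Fin n))
      balls = map ball.members centres

      balls-unique : Unique (concat balls)
      balls-unique = Unique.concat⁺
        (All.map⁺ (All.universal ball.unique centres))
        (AllPairs.map⁺ (AllPairs.map (λ apart {_} (u∈x , u∈w) → apart (lose u∈x u∈w)) centres-apart))

      balls⊆A : concat balls ⊆ₗ A
      balls⊆A = concat-map-⊆ ball.members centres ball.subset

      length-balls : ∀ S → length (concat (map ball.members S)) ≡ length S ℕ.* suc s
      length-balls []      = refl
      length-balls (x ∷ S) = trans (List.length-++ (ball.members x))
                                   (cong₂ ℕ._+_ (ball.size x) (length-balls S))

      net : List (Fin n)
      net = map ball.point centres

      -- The ball at x meets that of a centre w of no larger radius, so the net point
      -- of w is within three radii of x.
      bunch⊆ball : ∀ x → bunch A net x ⊆ₗ ball.members x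
      bunch⊆ball x u∈ with ∈-filter⁻ (bunch? net x) {xs = A} u∈ | centres-cover (∈-order x)
      ... | u∈A , far-net | w , w∈ , rw≤rx , meets with find meets
      ...   | v , v∈x , v∈w = ball.complete x u∈A (bunch-inside-ball rw≤rx
        (≤-trans (dist-triangle x v z) (ℚ.+-monoʳ-≤ (dist x v) (dist-triangle v w z)))
        (ball.within x v∈x)
        (≤-trans (≤-reflexive (dist-sym v w)) (ball.within w v∈w))
        (ball.within w (ball.point∈ w))
        (All.lookup far-net (∈-map⁺ ball.point w∈)))
        where z = ball.point w

    packedNet : Net A (suc s)
    packedNet = record
      { net        = net
      ; net-unique = AllPairs.map⁺ (AllPairs.map
          (λ {x} {w} apart eq → apart (lose (ball.point∈ x) (subst (_∈ ball.members w) (sym eq) (ball.point∈ w))))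
          centres-apart)
      -- The balls around the centres are disjoint subsets of `A` with `s + 1` elements each.
      ; sparse     = begin
          length net ℕ.* suc s     ≡⟨ cong (ℕ._* suc s) (List.length-map ball.point centres) ⟩
          length centres ℕ.* suc s ≡⟨ length-balls centres ⟨
          length (concat balls)    ≤⟨ unique⊆⇒length≤ balls-unique balls⊆A ⟩
          length A                 ∎
      ; few        = λ x → begin
          length (bunch A net x)   ≤⟨ unique⊆⇒length≤ (Unique.filter⁺ (bunch? net x) A!) (bunch⊆ball x) ⟩
          length (ball.members x)  ≡⟨ ball.size x ⟩
          suc s                    ∎
      }
      where open ℕ.≤-Reasoning

  abstract
    sparseNet : ∀ {A} → Unique A → ∀ s → Net A (suc s)
    sparseNet {A} A! s with length A ℕ.≤? s
    ... | yes A≤s = trivialNet (ℕ.m≤n⇒m≤1+n A≤s)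
    ... | no  A≰s = packedNet A! s (ℕ.≰⇒> A≰s)

-- The hierarchy of nets and its trees

-- A path of length at most ℓ that has at most h edges outside of L.
Near : ∀ {n} (G : WeightedGraph n) (L : List (Fin n × Fin n)) → ℕ → Fin n → Fin n → ℚ → Set
Near G L h x y ℓ = ∃[ M ] length M ℕ.≤ h × (Σ[ π ∈ Walk (restrict G (L ++ M)) x y ] walkLength π ≤ ℓ)

walk-mono : ∀ {n} {G : WeightedGraph n} {L L′} → L ⊆ₗ L′ → ∀ {x y ℓ} →
            (Σ[ π ∈ Walk (restrict G L) x y ] walkLength π ≤ ℓ) →
            (Σ[ π ∈ Walk (restrict G L′) x y ] walkLength π ≤ ℓ)
walk-mono {G = G} {L} {L′} L⊆L′ (π , π≤ℓ) =
  embed {H = restrict G L} (restrict-mono G L⊆L′) π ,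
  ≤-trans (≤-reflexive (walkLength-embed {H = restrict G L} {G = restrict G L′} (restrict-mono G L⊆L′) π)) π≤ℓ

module _ {n} {G : WeightedGraph n} {L : List (Fin n × Fin n)} where

  near⁺ : ∀ {x y ℓ} → (Σ[ π ∈ Walk (restrict G L) x y ] walkLength π ≤ ℓ) → Near G L 0 x y ℓ
  near⁺ π = [] , z≤n , walk-mono ∈-++⁺ˡ π

  near-walk : ∀ {h x y ℓ} → Near G L h x y ℓ → Walk G x y
  near-walk (M , _ , π , _) = embed {H = restrict G (L ++ M)} (restrict-⊆ G (L ++ M)) π

  near-edge : ∀ {x y w} → weight G x y ≡ just w → Near G L 1 x y w
  near-edge {x} {y} {w} e = (x , y) ∷ [] , s≤s z≤n ,
    edge (restrict-edge G (L ++ (x , y) ∷ []) (∈-++⁺ʳ L (here refl)) e) ,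
    ≤-reflexive (ℚ.+-identityʳ w)

  near-mono : ∀ {h h′ x y ℓ ℓ′} → Near G L h x y ℓ → h ℕ.≤ h′ → ℓ ≤ ℓ′ → Near G L h′ x y ℓ′
  near-mono (M , ≤h , π , ≤ℓ) h≤h′ ℓ≤ℓ′ = M , ℕ.≤-trans ≤h h≤h′ , π , ≤-trans ≤ℓ ℓ≤ℓ′

  near-refl : ∀ {x} → Near G L 0 x x 0ℚ
  near-refl = [] , z≤n , done , ≤-refl

  near-sym : ∀ {h x y ℓ} → Near G L h x y ℓ → Near G L h y x ℓ
  near-sym (M , ≤h , π , ≤ℓ) =
    M , ≤h , reverse π , ≤-trans (≤-reflexive (walkLength-reverse π)) ≤ℓ

  near-trans : ∀ {h h′ x y z ℓ ℓ′} → Near G L h x y ℓ → Near G L h′ y z ℓ′ →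
               Near G L (h ℕ.+ h′) x z (ℓ + ℓ′)
  near-trans (M , ≤h , π , ≤ℓ) (M′ , ≤h′ , π′ , ≤ℓ′)
    with walk-mono {L′ = L ++ (M ++ M′)} (left M M′) (π , ≤ℓ)
       | walk-mono {L′ = L ++ (M ++ M′)} (right M M′) (π′ , ≤ℓ′)
    where
    left : ∀ M M′ → L ++ M ⊆ₗ L ++ (M ++ M′)
    left M M′ e∈ with ∈-++⁻ L e∈
    ... | inj₁ ∈L = ∈-++⁺ˡ ∈L
    ... | inj₂ ∈M = ∈-++⁺ʳ L (∈-++⁺ˡ ∈M)
    right : ∀ M M′ → L ++ M′ ⊆ₗ L ++ (M ++ M′)
    right M M′ e∈ with ∈-++⁻ L e∈
    ... | inj₁ ∈L  = ∈-++⁺ˡ ∈L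
    ... | inj₂ ∈M′ = ∈-++⁺ʳ L (∈-++⁺ʳ M ∈M′)
  ... | ρ , ρ≤ | ρ′ , ρ′≤ =
    M ++ M′ , ℕ.≤-trans (ℕ.≤-reflexive (List.length-++ M)) (ℕ.+-mono-≤ ≤h ≤h′) ,
    ρ ∙ ρ′ , ≤-trans (≤-reflexive (walkLength-∙ ρ ρ′)) (+-mono-≤ ρ≤ ρ′≤)

-- Weights are positive, so each step strictly lowers `f`, and on a finite vertex set the descent
-- must end in `T`. The inequalities `w + f y ≤ f x` telescope to the bound on the length. The
-- potential `f` will be the distance to a fixed vertex or to a level.
follow : ∀ {n} (G : WeightedGraph n) L (f : Fin n → ℚ) {Q T : Fin n → Set} →
         (∀ {x} → Q x → (T x × 0ℚ ≤ f x) ⊎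
           (∃[ y ] ∃[ w ] (x , y) ∈ L × weight G x y ≡ just w × w + f y ≤ f x × Q y)) →
         ∀ {x} → Q x → ∃[ z ] T z × (Σ[ π ∈ Walk (restrict G L) x z ] walkLength π ≤ f x)
follow {n} G L f {Q} {T} next q = go (spo-wellFounded (On.isStrictPartialOrder f ℚ.<-isStrictPartialOrder) _) q
  where
  Reach : Fin n → Set
  Reach x = ∃[ z ] T z × (Σ[ π ∈ Walk (restrict G L) x z ] walkLength π ≤ f x)

  closer : ∀ {x y w} → weight G x y ≡ just w → w + f y ≤ f x → f y < f x
  closer {x} {y} {w} e w+fy≤fx = linear-< (ℚ.+-mono-<-≤ (positive G e) w+fy≤fx)
    (solve 3 (λ a b w → a :+ (con 0ℚ :+ (w :+ b)) := b :+ (w :+ a)) refl (f x) (f y) w)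

  extend : ∀ {x y w} → (x , y) ∈ L → weight G x y ≡ just w → w + f y ≤ f x → Reach y → Reach x
  extend {w = w} xy∈L e w+fy≤fx (z , t , π , π≤fy) =
    z , t , step (restrict-edge G L xy∈L e) π , ≤-trans (ℚ.+-monoʳ-≤ w π≤fy) w+fy≤fx

  go : ∀ {x} → Acc (λ y z → f y < f z) x → Q x → Reach x
  go {x} (acc smaller) q with next q
  ... | inj₁ (t , 0≤fx) = x , t , done , 0≤fx
  ... | inj₂ (y , w , xy∈L , e , w+fy≤fx , q′) =
    extend xy∈L e w+fy≤fx (go (smaller (closer e w+fy≤fx)) q′)

module Hierarchy {n} {G : WeightedGraph n} (m : Metric G) (s : ℕ) where
  open Metric m
  open Nets m

  levels : ℕ → Σ[ A ∈ List (Fin n) ] Unique A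
  levels zero    = allFin n , Unique.allFin⁺ n
  levels (suc i) = let N = sparseNet (proj₂ (levels i)) s in Net.net N , Net.net-unique N

  level : ℕ → List (Fin n)
  level i = proj₁ (levels i)

  levelNet : ∀ i → Net (level i) (suc s)
  levelNet i = sparseNet (proj₂ (levels i)) s

  length-level : ∀ i → length (level i) ℕ.* suc s ℕ.^ i ℕ.≤ n
  length-level zero    = ℕ.≤-reflexive (trans (ℕ.*-identityʳ _) (List.length-tabulate {n = n} id))
  length-level (suc i) = begin
    length (level (suc i)) ℕ.* (suc s ℕ.* suc s ℕ.^ i) ≡⟨ ℕ.*-assoc (length (level (suc i))) _ _ ⟨
    length (level (suc i)) ℕ.* suc s ℕ.* suc s ℕ.^ i   ≤⟨ ℕ.*-monoˡ-≤ (suc s ℕ.^ i) (Net.sparse (levelNet i)) ⟩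
    length (level i) ℕ.* suc s ℕ.^ i                   ≤⟨ length-level i ⟩
    n                                                  ∎
    where open ℕ.≤-Reasoning

  bunchAt : ℕ → Fin n → List (Fin n)
  bunchAt i = bunch (level i) (level (suc i))

  firstVertex : ∀ {x u} → Walk G x u → Fin n
  firstVertex {x} done             = x
  firstVertex     (step {x = y} _ _) = y

  -- If u is unreachable then parent x u = x; the pair (x , x) is harmless in an
  -- edge list, since G has no loops.
  parent : Fin n → Fin n → Fin n
  parent x u with dist x u ℚ.<? far
  ... | yes d<far = firstVertex (proj₁ (dist-attained d<far))
  ... | no  _     = x

  parent-step : ∀ {x u} → dist x u < far →
    x ≡ u ⊎ (∃[ w ] weight G x (parent x u) ≡ just w × w + dist (parent x u) u ≤ dist x u)
  parent-step {x} {u} d<far with dist x u ℚ.<? far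
  ... | no  d≮far = ⊥-elim (d≮far d<far)
  ... | yes d<far′ with dist-attained d<far′
  ...   | done , _                    = inj₁ refl
  ...   | step {w = w} e π , len≡dist = inj₂ (w , e ,
            ≤-trans (ℚ.+-monoʳ-≤ w (dist-shortest π)) (≤-reflexive len≡dist))

  pivot : List (Fin n) → Fin n → Fin n
  -- Any default will do: `restrict` keeps only edges of `G`, so the pair it contributes to the
  -- trees does no harm.
  pivot []       x = x
  pivot (z ∷ zs) x = argmin (dist x) z zs

  pivot-nearest : ∀ {N z} → z ∈ N → ∀ x → dist x (pivot N x) ≤ dist x z
  pivot-nearest {z ∷ zs} (here refl) x = f[argmin]≤f[⊤] {f = dist x} z zs
  pivot-nearest {z ∷ zs} (there z∈)  x = All.lookup (f[argmin]≤f[xs] {f = dist x} z zs) z∈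

  pivot∈ : ∀ {N z} → z ∈ N → ∀ x → pivot N x ∈ N
  pivot∈ {z ∷ zs} _ x with argmin-sel (dist x) z zs
  ... | inj₁ eq = here eq
  ... | inj₂ ∈zs = there ∈zs

  -- Each vertex stores only the first edge towards its pivot and towards each point of its bunch.
  -- Whole tree paths arise by concatenating the edges stored at successive vertices.
  treeEdges : ℕ → Fin n → List (Fin n × Fin n)
  treeEdges i x = (x , parent x (pivot (level i) x)) ∷ map (λ u → x , parent x u) (bunchAt i x)

  trees : ℕ → List (Fin n × Fin n)
  trees k = concatMap (λ i → concatMap (treeEdges i) (allFin n)) (upTo k)

  length-trees : ∀ k → length (trees k) ℕ.≤ k ℕ.* (n ℕ.* (2 ℕ.+ s))
  length-trees k = ℕ.≤-trans
    (length-concatMap-≤ _ (upTo k) λ i → length-concatMap-≤ (treeEdges i) (allFin n) λ x →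
      s≤s (ℕ.≤-trans (ℕ.≤-reflexive (List.length-map _ (bunchAt i x))) (Net.few (levelNet i) x)))
    (ℕ.≤-reflexive (cong₂ (λ a b → a ℕ.* (b ℕ.* (2 ℕ.+ s))) (List.length-upTo k) (List.length-tabulate {n = n} id)))

  treeEdges⊆trees : ∀ {i k} → i ℕ.< k → ∀ x → treeEdges i x ⊆ₗ trees k
  treeEdges⊆trees i<k x e∈ = ∈-concatMap⁺ _ (lose (∈-upTo⁺ i<k)
    (∈-concatMap⁺ _ (lose (∈-allFin x) e∈)))

  -- One step towards `u` along an edge of weight `w` lowers three times the distance to `u` by at
  -- least `3w`, but the distance to a net point by at most `w`.
  bunch-closed : ∀ {w d d′ e e′} → 0ℚ < w → w + d′ ≤ d → d + d + d < e → e ≤ w + e′ →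
                 d′ + d′ + d′ < e′
  bunch-closed {w} {d} {d′} {e} {e′} 0<w w+d′≤d 3d<e e≤w+e′ = linear-<
    (ℚ.+-mono-<-≤ 3d<e (+-mono-≤ (+-mono-≤ (+-mono-≤ w+d′≤d w+d′≤d) w+d′≤d)
                        (+-mono-≤ e≤w+e′ (+-mono-≤ (ℚ.<⇒≤ 0<w) (ℚ.<⇒≤ 0<w)))))
    (solve 5 (λ w d d′ e e′ →
       e′ :+ ((d :+ d :+ d) :+ ((((w :+ d′) :+ (w :+ d′)) :+ (w :+ d′)) :+ (e :+ (con 0ℚ :+ con 0ℚ))))
       := (d′ :+ d′ :+ d′) :+ (e :+ (((d :+ d) :+ d) :+ ((w :+ e′) :+ (w :+ w)))))
       refl w d d′ e e′)

  step-decreases : ∀ {w d d′} → 0ℚ < w → w + d′ ≤ d → d′ ≤ d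
  step-decreases {w} {d} {d′} 0<w w+d′≤d = linear-≤ (+-mono-≤ (ℚ.<⇒≤ 0<w) w+d′≤d)
    (solve 3 (λ w d d′ → d :+ (con 0ℚ :+ (w :+ d′)) := d′ :+ (w :+ d)) refl w d d′)

  dist≤weight : ∀ {x y w} → weight G x y ≡ just w → dist x y ≤ w
  dist≤weight {w = w} e = ≤-trans (dist-shortest (edge e)) (≤-reflexive (ℚ.+-identityʳ w))

  -- Follow parents towards `u`. By `bunch-closed`, `u` stays in the bunch of every vertex on the
  -- way, so the next edge has always been stored.
  bunch-tree : ∀ {i k} → i ℕ.< k → ∀ {x u} → u ∈ level i → Bunch (level (suc i)) x u →
               dist x u < far → Near G (trees k) 0 x u (dist x u)
  bunch-tree {i} {k} i<k {x} {u} u∈ b d<far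
    with follow G (trees k) (λ y → dist y u) {T = _≡ u} next (b , d<far)
    where
    next : ∀ {x} → Bunch (level (suc i)) x u × dist x u < far → (x ≡ u × 0ℚ ≤ dist x u) ⊎
           (∃[ y ] ∃[ w ] (x , y) ∈ trees k × weight G x y ≡ just w × w + dist y u ≤ dist x u ×
              Bunch (level (suc i)) y u × dist y u < far)
    next {x} (b , d<far) with parent-step d<far
    ... | inj₁ x≡u = inj₁ (x≡u , dist-nonneg x u)
    ... | inj₂ (w , e , w+d′≤d) = inj₂ (parent x u , w ,
      treeEdges⊆trees i<k x (there (∈-map⁺ _ (∈-filter⁺ (bunch? (level (suc i)) x) u∈ b))) ,
      e , w+d′≤d ,
      All.map (λ {z} b → bunch-closed (positive G e) w+d′≤d b
        (≤-trans (dist-triangle x (parent x u) z) (ℚ.+-monoˡ-≤ _ (dist≤weight e)))) b ,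
      ℚ.≤-<-trans (step-decreases (positive G e) w+d′≤d) d<far)
  ... | _ , refl , π = near⁺ π

  -- The pivot may change along the way, but the distance to the current pivot drops by at least the
  -- weight of each edge. The walk therefore ends at some point `z′` of the level, possibly other
  -- than `z`.
  pivot-tree : ∀ {i k} → i ℕ.< k → ∀ {x z} → z ∈ level i → dist x z < far →
               ∃[ z′ ] z′ ∈ level i × Near G (trees k) 0 x z′ (dist x z)
  pivot-tree {i} {k} i<k {x} {z} z∈ d<far
    with follow G (trees k) (λ y → dist y (pivot (level i) y)) {T = _∈ level i} next
           (ℚ.≤-<-trans (pivot-nearest z∈ x) d<far)
    where
    next : ∀ {x} → dist x (pivot (level i) x) < far →
           (x ∈ level i × 0ℚ ≤ dist x (pivot (level i) x)) ⊎
           (∃[ y ] ∃[ w ] (x , y) ∈ trees k × weight G x y ≡ just w ×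
              w + dist y (pivot (level i) y) ≤ dist x (pivot (level i) x) ×
              dist y (pivot (level i) y) < far)
    next {x} d<far with parent-step d<far
    ... | inj₁ x≡p = inj₁ (subst (_∈ level i) (sym x≡p) (pivot∈ z∈ x) , dist-nonneg x _)
    ... | inj₂ (w , e , w+d′≤d) = inj₂ (_ , w , treeEdges⊆trees i<k x (here refl) , e , closer ,
        ℚ.≤-<-trans (step-decreases (positive G e) closer) d<far)
      where closer = ≤-trans (ℚ.+-monoʳ-≤ w (pivot-nearest (pivot∈ z∈ x) _)) w+d′≤d
  ... | z′ , z′∈ , π , π≤ = z′ , z′∈ , near⁺ (π , ≤-trans π≤ (pivot-nearest z∈ x))

-- The stretch analysis

-- Natural multiples as iterated sums, so that `suc N ⋆ t` unfolds to one piece of length `t` and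
-- `N` further ones.
infixr 7 _⋆_
_⋆_ : ℕ → ℚ → ℚ
zero  ⋆ t = 0ℚ
suc k ⋆ t = t + k ⋆ t

⋆-*-assoc : ∀ k t d → k ⋆ (t * d) ≡ (k ⋆ t) * d
⋆-*-assoc zero    t d = sym (ℚ.*-zeroˡ d)
⋆-*-assoc (suc k) t d = trans (cong (t * d +_) (⋆-*-assoc k t d)) (sym (ℚ.*-distribʳ-+ d t (k ⋆ t)))

4× : ℚ → ℚ
4× q = q + q + q + q

4×-mono : ∀ {p q} → p ≤ q → 4× p ≤ 4× q
4×-mono p≤q = +-mono-≤ (+-mono-≤ (+-mono-≤ p≤q p≤q) p≤q) p≤q

abstract
  *-monoˡ : ∀ {c p q} → 0ℚ ≤ c → p ≤ q → c * p ≤ c * q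
  *-monoˡ {c} 0≤c = ℚ.*-monoˡ-≤-nonNeg c {{nonNegative 0≤c}}

  *-monoʳ : ∀ {c p q} → 0ℚ ≤ c → p ≤ q → p * c ≤ q * c
  *-monoʳ {c} 0≤c = ℚ.*-monoʳ-≤-nonNeg c {{nonNegative 0≤c}}

  ≤-scale : ∀ {σ a} → 1ℚ ≤ σ → 0ℚ ≤ a → a ≤ σ * a
  ≤-scale {σ} {a} 1≤σ 0≤a = ≤-trans (≤-reflexive (sym (ℚ.*-identityˡ a))) (*-monoʳ 0≤a 1≤σ)

  0≤1≤ : ∀ {σ} → 1ℚ ≤ σ → 0ℚ ≤ σ
  0≤1≤ = ≤-trans (ℚ.nonNegative⁻¹ 1ℚ)

  stretch-join : ∀ {σ a b d} → 1ℚ ≤ σ → a + b ≤ d → σ * a + σ * b ≤ σ * d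
  stretch-join {σ} {a} {b} 1≤σ a+b≤d =
    ≤-trans (≤-reflexive (sym (ℚ.*-distribˡ-+ σ a b))) (*-monoˡ (0≤1≤ 1≤σ) a+b≤d)

  stretch-join-edge : ∀ {σ a w b d} → 1ℚ ≤ σ → 0ℚ ≤ w → a + w + b ≤ d → σ * a + w + σ * b ≤ σ * d
  stretch-join-edge {σ} {a} {w} {b} {d} 1≤σ 0≤w le =
    linear-≤ (+-mono-≤ (≤-scale 1≤σ 0≤w) (*-monoˡ (0≤1≤ 1≤σ) le))
      (solve 5 (λ σ a w b d → σ :* d :+ (w :+ σ :* (a :+ w :+ b)) :=
                              (σ :* a :+ w :+ σ :* b) :+ (σ :* w :+ σ :* d)) refl σ a w b d)

  remaining-≤ : ∀ {a w c d t r} → t ≤ a + w → a + w + c ≤ d → d ≤ t + r → c ≤ r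
  remaining-≤ {a} {w} {c} {d} {t} {r} p q r′ = linear-≤ (+-mono-≤ p (+-mono-≤ q r′))
    (solve 6 (λ a w c d t r → r :+ (t :+ ((a :+ w :+ c) :+ d)) :=
                              c :+ ((a :+ w) :+ (d :+ (t :+ r)))) refl a w c d t r)

  -- Variables are distances named by their endpoints, and `w` is the weight of an edge from `v` to
  -- `u`. If this edge lies on a shortest path from `a` to `y`, and `b` on one from `u` to `y`, then
  -- the route from `a` over the edge to `b` is itself shortest.
  prefix-≤ : ∀ {av w uy ay ub by ab} → av + w + uy ≤ ay → ub + by ≤ uy → ay ≤ ab + by →
             av + w + ub ≤ ab
  prefix-≤ {av} {w} {uy} {ay} {ub} {by} {ab} p q r = linear-≤ (+-mono-≤ p (+-mono-≤ q r))
    (solve 7 (λ av w uy ay ub by ab →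
       ab :+ ((av :+ w :+ uy) :+ ((ub :+ by) :+ ay)) :=
       (av :+ w :+ ub) :+ (ay :+ (uy :+ (ab :+ by)))) refl av w uy ay ub by ab)

  between-≤ : ∀ {av w uy ay ub by ab} → av + w + uy ≤ ay → ub + by ≤ uy → ab ≤ av + w + ub →
              ab + by ≤ ay
  between-≤ {av} {w} {uy} {ay} {ub} {by} {ab} p q r = linear-≤ (+-mono-≤ p (+-mono-≤ q r))
    (solve 7 (λ av w uy ay ub by ab →
       ay :+ ((av :+ w :+ uy) :+ ((ub :+ by) :+ ab)) :=
       (ab :+ by) :+ (ay :+ (uy :+ (av :+ w :+ ub)))) refl av w uy ay ub by ab)

  -- The route is `x`, `b`, `z`, `z′`, `b′`, `y`. Its middle part costs at most `bb + 4q`; here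
  -- `bb ≤ σ * bb` is absorbed into `σ * d`, and `4q` into `t * d`.
  detour-≤ : ∀ {σ xb bz zz bz′ by bb d q t} → 1ℚ ≤ σ → 0ℚ ≤ bb →
             bz ≤ q → bz′ ≤ q → zz ≤ q + (bb + q) → xb + (bb + by) ≤ d → q + q + q + q ≤ t * d →
             σ * xb + (bz + (zz + (bz′ + σ * by))) ≤ (σ + t) * d
  detour-≤ {σ} {xb} {bz} {zz} {bz′} {by} {bb} {d} {q} {t} 1≤σ 0≤bb p₁ p₂ p₃ p₄ p₅ =
    linear-≤ (+-mono-≤ p₁ (+-mono-≤ p₂ (+-mono-≤ p₃
               (+-mono-≤ (*-monoˡ (0≤1≤ 1≤σ) p₄) (+-mono-≤ p₅ (≤-scale 1≤σ 0≤bb))))))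
      (solve 10 (λ σ xb bz zz bz′ by bb d q t →
         ((σ :+ t) :* d) :+ (bz :+ (bz′ :+ (zz :+ (σ :* (xb :+ (bb :+ by)) :+
            ((q :+ q :+ q :+ q) :+ bb)))))
         := (σ :* xb :+ (bz :+ (zz :+ (bz′ :+ σ :* by)))) :+ (q :+ (q :+ ((q :+ (bb :+ q)) :+
            (σ :* d :+ (t :* d :+ σ :* bb)))))) refl σ xb bz zz bz′ by bb d q t)

  -- Going through `b` and `z` gives `xw ≤ xb + q + 3 (bb + 2q) = xb + 3 bb + 7q`, where `xb + 3 bb
  -- ≤ 3d` and `7q ≤ d`. With `q = 4 θ d` the last condition is `28 θ ≤ 1`.
  climb-≤ : ∀ {xb by bz zz zw xw bb d q} → 0ℚ ≤ xb → 0ℚ ≤ by → bz ≤ q → zz ≤ q + (bb + q) →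
            zw ≤ zz + zz + zz → xw ≤ xb + (bz + zw) → xb + (bb + by) ≤ d →
            q + q + q + q + q + q + q ≤ d → xw ≤ 4× d
  climb-≤ {xb} {by} {bz} {zz} {zw} {xw} {bb} {d} {q} 0≤xb 0≤by p₁ p₂ p₃ p₄ p₅ p₆ =
    linear-≤ (+-mono-≤ (+-mono-≤ (+-mono-≤ (+-mono-≤ 0≤xb 0≤xb) (+-mono-≤ (+-mono-≤ 0≤by 0≤by) 0≤by)) p₁)
                (+-mono-≤ (+-mono-≤ (+-mono-≤ p₂ p₂) p₂)
                  (+-mono-≤ p₃ (+-mono-≤ p₄ (+-mono-≤ (+-mono-≤ (+-mono-≤ p₅ p₅) p₅) p₆)))))
      (solve 9 (λ xb by bz zz zw xw bb d q →
         let O = con 0ℚ ; Q = q :+ (bb :+ q) ; X = xb :+ (bb :+ by) in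
         (d :+ d :+ d :+ d) :+ ((((O :+ O) :+ ((O :+ O) :+ O)) :+ bz) :+ (((zz :+ zz) :+ zz) :+
            (zw :+ (xw :+ (((X :+ X) :+ X) :+ (q :+ q :+ q :+ q :+ q :+ q :+ q))))))
         := xw :+ ((((xb :+ xb) :+ ((by :+ by) :+ by)) :+ q) :+ (((Q :+ Q) :+ Q) :+
            ((zz :+ zz :+ zz) :+ ((xb :+ (bz :+ zw)) :+ (((d :+ d) :+ d) :+ d))))))
         refl xb by bz zz zw xw bb d q)

7× : ℚ → ℚ
7× q = q + q + q + q + q + q + q

private
  7×4×-* : ∀ t d → 7× (4× (t * d)) ≡ 7× (4× t) * d
  7×4×-* = solve 2 (λ t d →
    let e = t :* d ; p = e :+ e :+ e :+ e ; q = t :+ t :+ t :+ t in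
    p :+ p :+ p :+ p :+ p :+ p :+ p := (q :+ q :+ q :+ q :+ q :+ q :+ q) :* d) refl

  4×4×-* : ∀ t d → 4× (4× (t * d)) ≡ 4× (4× t) * d
  4×4×-* = solve 2 (λ t d →
    let e = t :* d ; p = e :+ e :+ e :+ e ; q = t :+ t :+ t :+ t in
    p :+ p :+ p :+ p := (q :+ q :+ q :+ q) :* d) refl

  3×≤4× : ∀ {a b} → 0ℚ ≤ b → a ≤ b + b + b → a ≤ 4× b
  3×≤4× {a} {b} 0≤b a≤3b = linear-≤ (+-mono-≤ 0≤b a≤3b)
    (solve 2 (λ a b → (b :+ b :+ b :+ b) :+ (con 0ℚ :+ a) := a :+ (b :+ (b :+ b :+ b))) refl a b)

  4×≤7× : ∀ {q} → 0ℚ ≤ q → 4× q ≤ 7× q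
  4×≤7× {q} 0≤q = linear-≤ (+-mono-≤ (+-mono-≤ 0≤q 0≤q) 0≤q)
    (solve 1 (λ q → (q :+ q :+ q :+ q :+ q :+ q :+ q) :+ ((con 0ℚ :+ con 0ℚ) :+ con 0ℚ) :=
                    (q :+ q :+ q :+ q) :+ ((q :+ q) :+ q)) refl q)

  ≤4× : ∀ {q} → 0ℚ ≤ q → q ≤ 4× q
  ≤4× {q} 0≤q = linear-≤ (+-mono-≤ (+-mono-≤ 0≤q 0≤q) 0≤q)
    (solve 1 (λ q → (q :+ q :+ q :+ q) :+ ((con 0ℚ :+ con 0ℚ) :+ con 0ℚ) :=
                    q :+ ((q :+ q) :+ q)) refl q)

  ≤7× : ∀ {q} → 0ℚ ≤ q → q ≤ 7× q
  ≤7× 0≤q = ≤-trans (≤4× 0≤q) (4×≤7× 0≤q)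

  4×≤5× : ∀ {q} → 0ℚ ≤ q → 4× q ≤ 4× q + q
  4×≤5× {q} 0≤q = ≤-trans (≤-reflexive (sym (ℚ.+-identityʳ (4× q)))) (ℚ.+-monoʳ-≤ (4× q) 0≤q)

-- Each level adds `16 θ`, since a detour costs four extra terms of at most `4 θ d`.
stretch : ℚ → ℕ → ℚ
stretch θ zero    = 1ℚ
stretch θ (suc i) = stretch θ i + 4× (4× θ)

abstract
  stretch-mono : ∀ {θ} → 0ℚ ≤ θ → ∀ i → stretch θ i ≤ stretch θ (suc i)
  stretch-mono {θ} 0≤θ i = ≤-trans (≤-reflexive (sym (ℚ.+-identityʳ (stretch θ i))))
    (ℚ.+-monoʳ-≤ (stretch θ i) (≤-trans 0≤θ (≤-trans (≤4× 0≤θ) (≤4× (≤-trans 0≤θ (≤4× 0≤θ))))))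

  1≤stretch : ∀ {θ} → 0ℚ ≤ θ → ∀ i → 1ℚ ≤ stretch θ i
  1≤stretch 0≤θ zero    = ≤-refl
  1≤stretch 0≤θ (suc i) = ≤-trans (1≤stretch 0≤θ i) (stretch-mono 0≤θ i)

-- There are two scans, each of at most `K` pieces; a piece costs the hops of the previous level and
-- one edge that crosses to the next piece. Tree edges are free.
hops : ℕ → ℕ → ℕ
hops K zero    = 0
hops K (suc i) = K ℕ.* (hops K i ℕ.+ 1) ℕ.+ K ℕ.* (hops K i ℕ.+ 1)

-- A shortest path from x to y is cut into suc K pieces of length at most
-- θ * dist x y.
module Stretch {n} {G : WeightedGraph n} (m : Metric G) (s k : ℕ) (θ : ℚ) (0≤θ : 0ℚ ≤ θ)
               (K : ℕ) (K⋆θ≡1 : suc K ⋆ θ ≡ 1ℚ) (28θ≤1 : 7× (4× θ) ≤ 1ℚ) where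
  open Metric m
  open Nets m
  open Hierarchy m s

  private
    0≤4× : ∀ {q} → 0ℚ ≤ q → 0ℚ ≤ 4× q
    0≤4× 0≤q = ≤-trans 0≤q (≤4× 0≤q)

    σ : ℕ → ℚ
    σ = stretch θ

    h : ℕ → ℕ
    h = hops (suc K)

    NearT : ℕ → Fin n → Fin n → ℚ → Set
    NearT = Near G (trees k)

    abstract
      4×dist<far : ∀ {x y} → Walk G x y → 4× (dist x y) < far
      4×dist<far {x} {y} π = ℚ.≤-<-trans (4×≤5× (dist-nonneg x y)) (dist≪far π)

      dist<far : ∀ {x y} → Walk G x y → dist x y < far
      dist<far {x} {y} π = ℚ.≤-<-trans (≤4× (dist-nonneg x y)) (4×dist<far π)

    near-dist : ∀ {h x y ℓ} → NearT h x y ℓ → dist x y ≤ ℓ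
    near-dist (M , _ , π , π≤ℓ) = ≤-trans (dist-shortest (embed (restrict-⊆ G (trees k ++ M)) π))
      (≤-trans (≤-reflexive (walkLength-embed (restrict-⊆ G (trees k ++ M)) π)) π≤ℓ)

  Good : ℕ → Set
  Good i = ∀ {x y} → Walk G x y → NearT (h i) x y (σ i * dist x y) ⊎
             (∃[ z ] z ∈ level (suc i) × dist x z ≤ 4× (dist x y))

  Climb : ℕ → Fin n → Fin n → Set
  Climb i x y = ∃[ z ] z ∈ level i × dist x z ≤ dist x y + dist x y + dist x y

  -- If `u` is outside the bunch of `x`, then some point of the next level violates the defining
  -- inequality, which is the required bound.
  jump : ∀ {i x u} → i ℕ.< k → u ∈ level i → Walk G x u →
         NearT 0 x u (dist x u) ⊎ Climb (suc i) x u
  jump {i} {x} {u} i<k u∈ π with bunch? (level (suc i)) x u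
  ... | yes b = inj₁ (bunch-tree i<k u∈ b (dist<far π))
  ... | no ¬b with find (All.¬All⇒Any¬ (λ z → _ ℚ.<? dist x z) _ ¬b)
  ...   | z , z∈ , 3d≮ = inj₂ (z , z∈ , ℚ.≮⇒≥ 3d≮)

  -- Level 0 contains all vertices, so `jump` applies to `y` itself.
  good-zero : 0 ℕ.< k → Good 0
  good-zero 0<k {x} {y} π with jump 0<k (∈-allFin y) π
  ... | inj₁ near           = inj₁ (near-mono near z≤n (≤-reflexive (sym (ℚ.*-identityˡ _))))
  ... | inj₂ (z , z∈ , z≤) = inj₂ (z , z∈ , 3×≤4× (dist-nonneg x y) z≤)

  abstract
    compare : ∀ p q → p ≤ q ⊎ q ≤ p
    compare = ℚ.≤-total

    dist-via-edge : ∀ {a v u w} → weight G v u ≡ just w → dist a u ≤ dist a v + w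
    dist-via-edge {a} {v} {u} e = ≤-trans (dist-triangle a v u) (ℚ.+-monoʳ-≤ (dist a v) (dist≤weight e))

    +-shift-≤ : ∀ {a b w r d} → b ≤ a + w → a + (w + r) ≤ d → b + r ≤ d
    +-shift-≤ {a} {b} {w} {r} b≤ le =
      ≤-trans (ℚ.+-monoˡ-≤ r b≤) (≤-trans (≤-reflexive (ℚ.+-assoc a w r)) le)

  -- In the case `cut`, the edge from `v` to `u` reaches or crosses distance `t` on a shortest path.
  -- It may be much longer than `t`, so it is kept apart from the piece and paid for as one single
  -- edge.
  data Segment (a y : Fin n) (t : ℚ) : Set where
    short : dist a y ≤ t → Segment a y t
    cut   : ∀ {v u w} → Walk G a v → weight G v u ≡ just w → Walk G u y → dist a v ≤ t →
            t ≤ dist a v + w → dist a v + w + dist u y ≤ dist a y → Segment a y t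

  segment : ∀ {a y t} → 0ℚ ≤ t → Walk G a y → Segment a y t
  segment {a} {y} {t} 0≤t π with dist-attained (dist<far π)
  ... | π₀ , π₀≡d = go done π₀ (≤-trans (≤-reflexive (dist-refl a)) 0≤t)
      (≤-reflexive (trans (cong (_+ walkLength π₀) (dist-refl a)) (trans (ℚ.+-identityˡ _) π₀≡d)))
    where
    -- The last hypothesis keeps `v` on a shortest path from `a` to `y`.
    go : ∀ {v} → Walk G a v → (ρ : Walk G v y) → dist a v ≤ t →
         dist a v + walkLength ρ ≤ dist a y → Segment a y t
    go _  done av≤t _ = short av≤t
    go {v} π₁ (step {w = w} e ρ) av≤t le with compare (dist a v + w) t
    ... | inj₁ ≤t = go (π₁ ∙ edge e) ρ (≤-trans (dist-via-edge e) ≤t)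
                      (+-shift-≤ {dist a v} {w = w} {walkLength ρ} (dist-via-edge e) le)
    ... | inj₂ t≤ = cut π₁ e ρ av≤t t≤
                      (≤-trans (ℚ.+-monoʳ-≤ (dist a v + w) (dist-shortest ρ))
                               (+-shift-≤ {dist a v} {w = w} {walkLength ρ} ≤-refl le))

  -- In the second case `b` is the start of the first failing piece: it lies on a shortest path from
  -- `a` to `y`, is reached with the same stretch, and is close to the next level.
  Scan : ℕ → ℕ → Fin n → Fin n → ℚ → Set
  Scan i N a y t = NearT (N ℕ.* (h i ℕ.+ 1)) a y (σ i * dist a y) ⊎
    (∃[ b ] NearT (N ℕ.* (h i ℕ.+ 1)) a b (σ i * dist a b) × dist a b + dist b y ≤ dist a y ×
       (∃[ z ] z ∈ level (suc i) × dist b z ≤ 4× t))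

  stop : ∀ i N {a y} t → ∃[ z ] z ∈ level (suc i) × dist a z ≤ 4× t → Scan i N a y t
  stop i N {a} {y} t climb = inj₂ (a ,
    near-mono near-refl z≤n (≤-reflexive (sym (trans (cong (σ i *_) (dist-refl a)) (ℚ.*-zeroʳ (σ i))))) ,
    ≤-reflexive (trans (cong (_+ dist a y) (dist-refl a)) (ℚ.+-identityˡ _)) , climb)

  scan-piece : ∀ i N {a y} t → Good i → Walk G a y → dist a y ≤ t → Scan i (suc N) a y t
  scan-piece i N t good π d≤t with good π
  ... | inj₁ near           = inj₁ (near-mono near (ℕ.≤-trans (ℕ.m≤m+n (h i) 1) (ℕ.m≤m+n _ _)) ≤-refl)
  ... | inj₂ (z , z∈ , z≤) = stop i (suc N) t (z , z∈ , ≤-trans z≤ (4×-mono {q = t} d≤t))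

  scan : ∀ i N {a y} t → Good i → 0ℚ ≤ t → Walk G a y → dist a y ≤ suc N ⋆ t →
         Scan i (suc N) a y t
  scan i zero t good 0≤t π d≤ =
    scan-piece i 0 t good π (≤-trans d≤ (≤-reflexive (ℚ.+-identityʳ t)))
  scan i (suc N) {a} {y} t good 0≤t π d≤ with segment 0≤t π
  ... | short d≤t = scan-piece i (suc N) t good π d≤t
  ... | cut {v} {u} {w} π₁ e π₂ av≤t t≤ le with good π₁
  ...   | inj₂ (z , z∈ , z≤) = stop i (suc (suc N)) t (z , z∈ , ≤-trans z≤ (4×-mono {q = t} av≤t))
  -- The piece and its crossing edge cover at least `t`, so the rest fits into one piece fewer.
  ...   | inj₁ near with scan i N t good 0≤t π₂ (remaining-≤ {dist a v} {w} t≤ le d≤)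
  ...     | inj₁ near′ = inj₁ (near-mono (near-trans (near-trans near (near-edge e)) near′)
              ℕ.≤-refl (stretch-join-edge {a = dist a v} {w} (1≤stretch 0≤θ i) (ℚ.<⇒≤ (positive G e)) le))
  ...     | inj₂ (b , near′ , split , climb) = inj₂ (b ,
              near-mono (near-trans (near-trans near (near-edge e)) near′) ℕ.≤-refl
                (stretch-join-edge {a = dist a v} {w} (1≤stretch 0≤θ i) (ℚ.<⇒≤ (positive G e))
                  (prefix-≤ {dist a v} {w} {ub = dist u b} {dist b y} le split (dist-triangle a b y))) ,
              between-≤ {dist a v} {w} {ub = dist u b} {dist b y} le split ab≤ , climb)
    where
    ab≤ : dist a b ≤ dist a v + w + dist u b
    ab≤ = ≤-trans (dist-triangle a u b) (ℚ.+-monoˡ-≤ (dist u b) (dist-via-edge e))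

  private
    abstract
      dist≤K⋆t : ∀ {d} e → d ≤ e → d ≤ suc K ⋆ (θ * e)
      dist≤K⋆t e d≤e = ≤-trans d≤e (≤-reflexive (sym
        (trans (⋆-*-assoc (suc K) θ e) (trans (cong (_* e) K⋆θ≡1) (ℚ.*-identityˡ e)))))

      7×4×t≤dist : ∀ {d} → 0ℚ ≤ d → 7× (4× (θ * d)) ≤ d
      7×4×t≤dist {d} 0≤d = ≤-trans (≤-reflexive (7×4×-* θ d))
        (≤-trans (*-monoʳ 0≤d 28θ≤1) (≤-reflexive (ℚ.*-identityˡ d)))

      0≤t : ∀ {d} → 0ℚ ≤ d → 0ℚ ≤ θ * d
      0≤t {d} 0≤d = ≤-trans (≤-reflexive (sym (ℚ.*-zeroˡ d))) (*-monoʳ 0≤d 0≤θ)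

      pivot<far : ∀ {x y d} → Walk G x y → d ≤ 4× (θ * dist x y) → d < far
      pivot<far {x} {y} π d≤ = ℚ.≤-<-trans (≤-trans d≤
        (≤-trans (≤7× (0≤4× (0≤t (dist-nonneg x y)))) (7×4×t≤dist (dist-nonneg x y)))) (dist<far π)

      three-parts : ∀ {x y b b′} → dist x b + dist b y ≤ dist x y → dist y b′ + dist b′ b ≤ dist y b →
                    dist x b + (dist b b′ + dist y b′) ≤ dist x y
      three-parts {x} {y} {b} {b′} split split′ = ≤-trans (ℚ.+-monoʳ-≤ (dist x b)
        (≤-trans (≤-reflexive (trans (ℚ.+-comm (dist b b′) (dist y b′)) (cong (dist y b′ +_) (dist-sym b b′))))
          (≤-trans split′ (≤-reflexive (dist-sym y b))))) split

      dist-via-pivots : ∀ {b b′ z z′ q} → dist b z ≤ q → dist b′ z′ ≤ q → dist z z′ ≤ q + (dist b b′ + q)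
      dist-via-pivots {b} {b′} {z} {z′} bz≤q b′z′≤q =
        ≤-trans (dist-triangle z b z′) (+-mono-≤ (≤-trans (≤-reflexive (dist-sym z b)) bz≤q)
          (≤-trans (dist-triangle b b′ z′) (ℚ.+-monoʳ-≤ (dist b b′) b′z′≤q)))

  good-suc : ∀ i → suc i ℕ.< k → Good i → Good (suc i)
  good-suc i i<k good {x} {y} π
    with scan i K (θ * dist x y) good (0≤t (dist-nonneg x y)) π (dist≤K⋆t (dist x y) ≤-refl)
  ... | inj₁ near = inj₁ (near-mono near (ℕ.m≤m+n _ _) (*-monoʳ (dist-nonneg x y) (stretch-mono 0≤θ i)))
  ... | inj₂ (b , near , split , z₀ , z₀∈ , bz₀≤)
    -- The second scan runs from `y` back to `b`, not to `x`, so that `x`, `b`, `b′`, `y` occur in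
    -- this order on a shortest path. The piece length is unchanged, and `dist y b ≤ dist x y` makes
    -- `suc K` pieces suffice.
    with scan i K (θ * dist x y) good (0≤t (dist-nonneg x y)) (reverse π ∙ near-walk near)
           (dist≤K⋆t (dist x y) yb≤)
    where
    yb≤ : dist y b ≤ dist x y
    yb≤ = ≤-trans (≤-reflexive (dist-sym y b)) (≤-trans (≤-reflexive (sym (ℚ.+-identityˡ _)))
            (≤-trans (ℚ.+-monoˡ-≤ (dist b y) (dist-nonneg x b)) split))
  ...   | inj₁ near′ = inj₁ (near-mono (near-trans near (near-sym near′)) ℕ.≤-refl
            (≤-trans (stretch-join {a = dist x b} {dist y b} (1≤stretch 0≤θ i)
                       (≤-trans (ℚ.+-monoʳ-≤ (dist x b) (≤-reflexive (dist-sym y b))) split))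
              (*-monoʳ (dist-nonneg x y) (stretch-mono 0≤θ i))))
  ...   | inj₂ (b′ , near′ , split′ , z₀′ , z₀′∈ , b′z₀′≤)
    with pivot-tree i<k z₀∈ (pivot<far π bz₀≤) | pivot-tree i<k z₀′∈ (pivot<far π b′z₀′≤)
  ...     | z , z∈ , nearz | z′ , z′∈ , nearz′
    -- The concatenated walk witnesses that `z′` is reachable from `z`. A tree path between them
    -- yields the detour; otherwise the level above is near `z`, hence near `x`.
    with jump i<k z′∈ (near-walk (near-sym nearz) ∙ near-walk (near-sym near) ∙ π ∙
                       near-walk near′ ∙ near-walk nearz′)
  ...       | inj₁ nearzz′ = inj₁ (near-mono
              (near-trans near (near-trans nearz (near-trans nearzz′
                (near-trans (near-sym nearz′) (near-sym near′)))))
              ℕ.≤-refl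
              (detour-≤ {σ i} {dist x b} {by = dist y b′} {q = 4× (θ * dist x y)}
                (1≤stretch 0≤θ i) (dist-nonneg b b′) bz₀≤ b′z₀′≤
                (dist-via-pivots (≤-trans (near-dist nearz) bz₀≤) (≤-trans (near-dist nearz′) b′z₀′≤))
                (three-parts split split′)
                (≤-reflexive (4×4×-* θ (dist x y)))))
  ...       | inj₂ (u , u∈ , zu≤) = inj₂ (u , u∈ ,
              climb-≤ {dist x b} {dist y b′} {dist b z} {zw = dist z u} {bb = dist b b′} {q = 4× (θ * dist x y)}
                (dist-nonneg x b) (dist-nonneg y b′) (≤-trans (near-dist nearz) bz₀≤)
                (dist-via-pivots (≤-trans (near-dist nearz) bz₀≤) (≤-trans (near-dist nearz′) b′z₀′≤))
                zu≤ (≤-trans (dist-triangle x b u) (ℚ.+-monoʳ-≤ (dist x b) (dist-triangle b z u)))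
                (three-parts split split′) (7×4×t≤dist (dist-nonneg x y)))

  good : ∀ i → i ℕ.< k → Good i
  good zero    0<k = good-zero 0<k
  good (suc i) i<k = good-suc i i<k (good i (ℕ.<-trans (ℕ.n<1+n i) i<k))

near-preserver : ∀ {n} {G : WeightedGraph n} (m : Metric G) (s k : ℕ) θ → 0ℚ ≤ θ → ∀ K →
                 suc K ⋆ θ ≡ 1ℚ → 7× (4× θ) ≤ 1ℚ → n ℕ.< suc s ℕ.^ suc k → ∀ {x y} → Walk G x y →
                 Near G (Hierarchy.trees m s (suc k)) (hops (suc K) k) x y (stretch θ k * Metric.dist m x y)
near-preserver {n} m s k θ 0≤θ K K⋆θ≡1 28θ≤1 n<s^k π
  with Stretch.good m s (suc k) θ 0≤θ K K⋆θ≡1 28θ≤1 k ℕ.≤-refl π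
... | inj₁ near          = near
-- A point on level `suc k` would force `suc s ^ suc k ≤ n`.
... | inj₂ (z , z∈ , _) = ⊥-elim (ℕ.<⇒≱ n<s^k (begin
  suc s ℕ.^ suc k                              ≡⟨ ℕ.*-identityˡ _ ⟨
  1 ℕ.* suc s ℕ.^ suc k                        ≤⟨ ℕ.*-monoˡ-≤ _ (∈-length z∈) ⟩
  length (Hierarchy.level m s (suc k)) ℕ.* suc s ℕ.^ suc k ≤⟨ Hierarchy.length-level m s (suc k) ⟩
  n                                            ∎))
  where open ℕ.≤-Reasoning

-- Assembling the preserver

module Preserver {n} (G : WeightedGraph n) (s k : ℕ) (θ : ℚ) (0≤θ : 0ℚ ≤ θ)
                 (K : ℕ) (K⋆θ≡1 : suc K ⋆ θ ≡ 1ℚ) (28θ≤1 : 7× (4× θ) ≤ 1ℚ)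
                 (n<s^k : n ℕ.< suc s ℕ.^ suc k) where
  private
    m = metric G

    abstract
      T₀ : List (Fin n × Fin n)
      T₀ = Hierarchy.trees m s (suc k)

      length-T₀ : length T₀ ℕ.≤ suc k ℕ.* (n ℕ.* (2 ℕ.+ s))
      length-T₀ = Hierarchy.length-trees m s (suc k)

      detour : ∀ {u v} → Walk G u v → Near G T₀ (hops (suc K) k) u v (stretch θ k * Metric.dist m u v)
      detour = near-preserver m s k θ 0≤θ K K⋆θ≡1 28θ≤1 n<s^k

    -- The walk is supplied by `shortest`, so the extra edges depend on the pair alone.
    extra : Fin n × Fin n → List (Fin n × Fin n)
    extra (u , v) with shortest G u v
    ... | reachable π _ = proj₁ (detour π)
    ... | unreachable _ = []

    length-extra : ∀ uv → length (extra uv) ℕ.≤ hops (suc K) k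
    length-extra (u , v) with shortest G u v
    ... | reachable π _ = proj₁ (proj₂ (detour π))
    ... | unreachable _ = z≤n

    extra-walk : ∀ {u v} (π : Walk G u v) → Σ[ ρ ∈ Walk (restrict G (T₀ ++ extra (u , v))) u v ]
                   walkLength ρ ≤ stretch θ k * walkLength π
    extra-walk {u} {v} π with shortest G u v
    ... | reachable π′ _ = let ρ , ρ≤ = proj₂ (proj₂ (detour π′)) in
            ρ , ≤-trans ρ≤ (*-monoˡ (0≤1≤ (1≤stretch 0≤θ k)) (Metric.dist-shortest m π))
    ... | unreachable ¬π = ⊥-elim (¬π π)

    kept : List (Fin n × Fin n) → List (Fin n × Fin n)
    kept P = T₀ ++ concatMap extra P

  preserver : List (Fin n × Fin n) → WeightedGraph n
  preserver P = restrict G (kept P)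

  preserver-size : ∀ P → let X = suc k ℕ.* (n ℕ.* (2 ℕ.+ s)) ℕ.+ length P ℕ.* hops (suc K) k in
                   ∣E preserver P ∣ ℕ.≤ X ℕ.+ X
  preserver-size P = ℕ.≤-trans (∣E-restrict∣≤ G (kept P)) (ℕ.+-mono-≤ kept≤ kept≤)
    where
    kept≤ = ℕ.≤-trans (ℕ.≤-reflexive (List.length-++ T₀))
      (ℕ.+-mono-≤ length-T₀ (length-concatMap-≤ extra P length-extra))

  isPreserver : ∀ {ε} P → stretch θ k ≤ 1ℚ + ε → IsPreserver ε G P (preserver P)
  isPreserver {ε} P σ≤1+ε = record { subgraph = restrict-⊆ G (kept P) ; stretch = stretched }
    where
    walk : ∀ {u v} → (u , v) ∈ P → (π : Walk G u v) →
           Σ[ ρ ∈ Walk (preserver P) u v ] walkLength ρ ≤ (1ℚ + ε) * walkLength π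
    walk {u} {v} uv∈P π = let ρ , ρ≤ = walk-mono included (extra-walk π) in
      ρ , ≤-trans ρ≤ (*-monoʳ (walkLength-nonneg π) σ≤1+ε)
      where
      included : T₀ ++ extra (u , v) ⊆ₗ kept P
      included e∈ with ∈-++⁻ T₀ e∈
      ... | inj₁ ∈T₀ = ∈-++⁺ˡ ∈T₀
      ... | inj₂ ∈M = ∈-++⁺ʳ T₀ (∈-concatMap⁺ extra (lose uv∈P ∈M))

    stretched : ∀ {u v} → (u , v) ∈ P → ∀ {d} → IsDist G u v d →
                ∃[ d* ] IsDist (preserver P) u v d* × d* ≤⁺ (1ℚ + ε) ·⁺ d
    stretched {u} {v} uv∈P (finite π _) with shortest (preserver P) u v | walk uv∈P π
    ... | reachable π* least | ρ , ρ≤ = _ , finite π* least , [ ≤-trans (least ρ) ρ≤ ]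
    ... | unreachable ¬ρ     | ρ , _  = ⊥-elim (¬ρ ρ)
    stretched {u} {v} uv∈P (infinite _) with shortest (preserver P) u v
    ... | reachable π* least = _ , finite π* least , (_ ≤⊤⁺)
    ... | unreachable ¬ρ     = _ , infinite ¬ρ , (_ ≤⊤⁺)

-- The graph itself serves when the exponent in the size bound is 1.
isPreserver-refl : ∀ {n ε} (G : WeightedGraph n) P → 0ℚ ≤ ε → IsPreserver ε G P G
isPreserver-refl {ε = ε} G P 0≤ε = record { subgraph = id ; stretch = λ _ → stretched }
  where
  stretched : ∀ {u v d} → IsDist G u v d → ∃[ d* ] IsDist G u v d* × d* ≤⁺ (1ℚ + ε) ·⁺ d
  stretched (finite π least) = _ , finite π least ,
    [ ≤-scale (≤-trans (≤-reflexive (sym (ℚ.+-identityʳ 1ℚ))) (ℚ.+-monoʳ-≤ 1ℚ 0≤ε)) (walkLength-nonneg π) ]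
  stretched (infinite ¬π)    = _ , infinite ¬π , (_ ≤⊤⁺)

-- Choice of the parameters

-- Given directly in lowest terms, so that `_≤_^_·_` computes at this exponent.
1/suc : ℕ → ℚ
1/suc k = mkℚ (pos 1) k (Coprime.1-coprimeTo (suc k))

toℚᵘ-⋆ : ∀ k q → toℚᵘ (k ⋆ q) ℚᵘ.≃ ℚᵘ.mkℚᵘ (pos k ℤ.* ↥ q) (ℚ.denominator-1 q)
toℚᵘ-⋆ zero    q = ℚᵘ.*≡* refl
toℚᵘ-⋆ (suc k) q@record{} = ℚᵘ.≃-trans (ℚ.toℚᵘ-homo-+ q (k ⋆ q))
  (ℚᵘ.≃-trans (ℚᵘ.+-congʳ (toℚᵘ q) (toℚᵘ-⋆ k q)) (ℚᵘ.*≡* (eq (↥ q) (pos k) (↧ q))))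
  where
  eq : ∀ a k d → (a ℤ.* d ℤ.+ (k ℤ.* a) ℤ.* d) ℤ.* d ≡ ((pos 1 ℤ.+ k) ℤ.* a) ℤ.* (d ℤ.* d)
  eq = R.solve 3 (λ a k d → (a R.:* d R.:+ (k R.:* a) R.:* d) R.:* d R.:=
                            ((R.con (pos 1) R.:+ k) R.:* a) R.:* (d R.:* d)) refl
    where module R = ℤ.+-*-Solver

suc⋆1/suc : ∀ k → suc k ⋆ 1/suc k ≡ 1ℚ
suc⋆1/suc k = ℚ.toℚᵘ-injective (ℚᵘ.≃-trans (toℚᵘ-⋆ (suc k) (1/suc k))
  (ℚᵘ.*≡* (trans (ℤ.*-identityʳ _) (trans (ℤ.*-identityʳ (pos (suc k))) (sym (ℤ.*-identityˡ (pos (suc k))))))))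

⋆-nonneg : ∀ k {q} → 0ℚ ≤ q → 0ℚ ≤ k ⋆ q
⋆-nonneg zero    0≤q = ≤-refl
⋆-nonneg (suc k) 0≤q = +-mono-≤ 0≤q (⋆-nonneg k 0≤q)

⋆-monoˡ-≤ : ∀ {j k q} → 0ℚ ≤ q → j ℕ.≤ k → j ⋆ q ≤ k ⋆ q
⋆-monoˡ-≤ {k = k} 0≤q z≤n       = ⋆-nonneg k 0≤q
⋆-monoˡ-≤ {q = q} 0≤q (s≤s j≤k) = ℚ.+-monoʳ-≤ q (⋆-monoˡ-≤ 0≤q j≤k)

⋆-monoʳ-≤ : ∀ k {p q} → p ≤ q → k ⋆ p ≤ k ⋆ q
⋆-monoʳ-≤ zero    p≤q = ≤-refl
⋆-monoʳ-≤ (suc k) p≤q = +-mono-≤ p≤q (⋆-monoʳ-≤ k p≤q)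

⋆-cancelˡ-≤ : ∀ k {p q} → suc k ⋆ p ≤ suc k ⋆ q → p ≤ q
⋆-cancelˡ-≤ k kp≤kq = ℚ.≮⇒≥ λ q<p →
  ℚ.<-irrefl refl (ℚ.<-≤-trans (ℚ.+-mono-<-≤ q<p (⋆-monoʳ-≤ k (ℚ.<⇒≤ q<p))) kp≤kq)

⋆-distribʳ-+ : ∀ q j k → (j ℕ.+ k) ⋆ q ≡ j ⋆ q + k ⋆ q
⋆-distribʳ-+ q zero    k = sym (ℚ.+-identityˡ (k ⋆ q))
⋆-distribʳ-+ q (suc j) k = trans (cong (q +_) (⋆-distribʳ-+ q j k)) (sym (ℚ.+-assoc q (j ⋆ q) (k ⋆ q)))

⋆-assoc : ∀ j k q → j ⋆ (k ⋆ q) ≡ (j ℕ.* k) ⋆ q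
⋆-assoc zero    k q = refl
⋆-assoc (suc j) k q = trans (cong (k ⋆ q +_) (⋆-assoc j k q)) (sym (⋆-distribʳ-+ q k (j ℕ.* k)))

-- Multiplying `ε` by its denominator `suc b` gives its numerator, a positive integer.
archimedean : ∀ {ε} → 0ℚ < ε → ∃[ b ] 1ℚ ≤ suc b ⋆ ε
archimedean {mkℚ (pos zero) _ _}      (ℚ.*<* (ℤ.+<+ ()))
archimedean {ε@(mkℚ (pos (suc a)) b _)} _ = b , ℚ.toℚᵘ-cancel-≤
  (ℚᵘ.≤-respʳ-≃ (ℚᵘ.≃-sym (toℚᵘ-⋆ (suc b) ε)) (ℚᵘ.*≤* (ℤ.+≤+ (begin
    1 ℕ.* suc b             ≡⟨ ℕ.*-comm 1 (suc b) ⟩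
    suc b ℕ.* 1             ≤⟨ ℕ.*-monoʳ-≤ (suc b) (s≤s z≤n) ⟩
    suc b ℕ.* suc a         ≡⟨ ℕ.*-identityʳ _ ⟨
    suc b ℕ.* suc a ℕ.* 1   ∎))))
  where open ℕ.≤-Reasoning
archimedean {mkℚ (ℤ.-[1+ _ ]) _ _}  (ℚ.*<* ())

4×≡4⋆ : ∀ q → 4× q ≡ 4 ⋆ q
4×≡4⋆ = solve 1 (λ q → q :+ q :+ q :+ q := q :+ (q :+ (q :+ (q :+ con 0ℚ)))) refl

7×≡7⋆ : ∀ q → 7× q ≡ 7 ⋆ q
7×≡7⋆ = solve 1 (λ q → q :+ q :+ q :+ q :+ q :+ q :+ q :=
                       q :+ (q :+ (q :+ (q :+ (q :+ (q :+ (q :+ con 0ℚ))))))) refl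

4×4×≡16⋆ : ∀ θ → 4× (4× θ) ≡ 16 ⋆ θ
4×4×≡16⋆ θ = trans (4×≡4⋆ (4× θ)) (trans (cong (4 ⋆_) (4×≡4⋆ θ)) (⋆-assoc 4 4 θ))

stretch≡ : ∀ θ k → stretch θ k ≡ 1ℚ + (k ℕ.* 16) ⋆ θ
stretch≡ θ zero    = sym (ℚ.+-identityʳ 1ℚ)
stretch≡ θ (suc k) = trans (cong₂ _+_ (stretch≡ θ k) (4×4×≡16⋆ θ))
  (trans (ℚ.+-assoc 1ℚ ((k ℕ.* 16) ⋆ θ) (16 ⋆ θ)) (cong (1ℚ +_)
    (trans (ℚ.+-comm ((k ℕ.* 16) ⋆ θ) (16 ⋆ θ)) (sym (⋆-distribʳ-+ θ 16 (k ℕ.* 16))))))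

record Scale (ε : ℚ) (k : ℕ) : Set where
  field
    θ       : ℚ
    K       : ℕ
    0≤θ     : 0ℚ ≤ θ
    K⋆θ≡1   : suc K ⋆ θ ≡ 1ℚ
    28θ≤1   : 7× (4× θ) ≤ 1ℚ
    stretch≤ : stretch θ k ≤ 1ℚ + ε

abstract
  scale : ∀ {ε} → 0ℚ < ε → ∀ k → Scale ε k
  scale {ε} 0<ε k with archimedean 0<ε
  ... | b , 1≤b·ε = record
    { θ        = θ
    ; K        = K
    ; 0≤θ      = 0≤θ
    ; K⋆θ≡1    = suc⋆1/suc K
    ; 28θ≤1    = ≤-trans (≤-reflexive (trans (7×≡7⋆ (4× θ)) (trans (cong (7 ⋆_) (4×≡4⋆ θ)) (⋆-assoc 7 4 θ))))
                   (≤K⇒≤1 (ℕ.m≤m+n 28 _))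
    ; stretch≤ = ≤-trans (≤-reflexive (stretch≡ θ k)) (ℚ.+-monoʳ-≤ 1ℚ {(k ℕ.* 16) ⋆ θ} {ε} (⋆-cancelˡ-≤ b
                   (≤-trans (≤-reflexive (⋆-assoc (suc b) (k ℕ.* 16) θ))
                     (≤-trans (≤K⇒≤1 (ℕ.m≤n+m _ 28)) 1≤b·ε))))
    }
    where
    K : ℕ
    -- Thus `suc K = 28 + suc b * 16 k`. The first summand gives `28 θ ≤ 1`; the second gives
    -- `suc b * 16 k θ ≤ 1 ≤ suc b * ε`, so the excess stretch `16 k θ` is at most `ε`.
    K = 27 ℕ.+ suc b ℕ.* (k ℕ.* 16)
    θ : ℚ
    θ = 1/suc K
    0≤θ : 0ℚ ≤ θ
    0≤θ = ℚ.nonNegative⁻¹ θ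
    ≤K⇒≤1 : ∀ {j} → j ℕ.≤ suc K → j ⋆ θ ≤ 1ℚ
    ≤K⇒≤1 j≤K = ≤-trans (⋆-monoˡ-≤ 0≤θ j≤K) (≤-reflexive (suc⋆1/suc K))

-- Integer roots and the size bound

floor-root : ∀ e n → ∃[ r ] r ℕ.^ suc e ℕ.≤ n × n ℕ.< suc r ℕ.^ suc e
floor-root e zero    = 0 , z≤n , ℕ.≤-reflexive (sym (ℕ.^-zeroˡ (suc e)))
floor-root e (suc n) with floor-root e n
... | r , r≤n , n<r with suc r ℕ.^ suc e ℕ.≤? suc n
...   | yes ≤n = suc r , ≤n , ℕ.≤-<-trans n<r (ℕ.^-monoˡ-< (suc e) ℕ.≤-refl)
...   | no ≰n  = r , ℕ.m≤n⇒m≤1+n r≤n , ℕ.≰⇒> ≰n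

-- The 6 comes from `2j` levels with `2 + r ≤ 3r` edges per vertex, the final 2 from the doubling in
-- `∣E-restrict∣≤`.
coefficient : ℕ → ℕ → ℕ
coefficient j h = (j ℕ.* 6 ℕ.+ h) ℕ.* 2

size≤coefficient : ∀ j h n p {r} → 1 ℕ.≤ r →
  let X = (j ℕ.+ j) ℕ.* (n ℕ.* (2 ℕ.+ r)) ℕ.+ p ℕ.* h in
  X ℕ.+ X ℕ.≤ (coefficient j h ℕ.* r) ℕ.* (n ℕ.+ p)
size≤coefficient j h n p {r} 1≤r = begin
  X ℕ.+ X                                     ≤⟨ ℕ.+-mono-≤ X≤ X≤ ⟩
  Y ℕ.* (n ℕ.+ p) ℕ.+ Y ℕ.* (n ℕ.+ p)          ≡⟨ double j h r (n ℕ.+ p) ⟩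
  coefficient j h ℕ.* r ℕ.* (n ℕ.+ p)          ∎
  where
  open ℕ.≤-Reasoning
  X = (j ℕ.+ j) ℕ.* (n ℕ.* (2 ℕ.+ r)) ℕ.+ p ℕ.* h
  Y = (j ℕ.* 6 ℕ.+ h) ℕ.* r

  double : ∀ j h r q → (j ℕ.* 6 ℕ.+ h) ℕ.* r ℕ.* q ℕ.+ (j ℕ.* 6 ℕ.+ h) ℕ.* r ℕ.* q ≡
                       (j ℕ.* 6 ℕ.+ h) ℕ.* 2 ℕ.* r ℕ.* q
  double = solve-∀

  regroup : ∀ j h r n p → (j ℕ.+ j) ℕ.* (n ℕ.* (r ℕ.+ r ℕ.+ r)) ℕ.+ p ℕ.* (h ℕ.* r) ℕ.+
                          (j ℕ.* 6 ℕ.* r ℕ.* p ℕ.+ h ℕ.* r ℕ.* n) ≡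
                          (j ℕ.* 6 ℕ.+ h) ℕ.* r ℕ.* (n ℕ.+ p)
  regroup = solve-∀

  X≤ : X ℕ.≤ Y ℕ.* (n ℕ.+ p)
  X≤ = begin
    X ≤⟨ ℕ.+-mono-≤ (ℕ.*-monoʳ-≤ (j ℕ.+ j) (ℕ.*-monoʳ-≤ n (ℕ.+-monoˡ-≤ r (ℕ.+-mono-≤ 1≤r 1≤r))))
                    (ℕ.*-monoʳ-≤ p (ℕ.m≤m*n h r {{ℕ.>-nonZero 1≤r}})) ⟩
    (j ℕ.+ j) ℕ.* (n ℕ.* (r ℕ.+ r ℕ.+ r)) ℕ.+ p ℕ.* (h ℕ.* r)  ≤⟨ ℕ.m≤m+n _ _ ⟩
    (j ℕ.+ j) ℕ.* (n ℕ.* (r ℕ.+ r ℕ.+ r)) ℕ.+ p ℕ.* (h ℕ.* r) ℕ.+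
      (j ℕ.* 6 ℕ.* r ℕ.* p ℕ.+ h ℕ.* r ℕ.* n)                  ≡⟨ regroup j h r n p ⟩
    Y ℕ.* (n ℕ.+ p)                                           ∎

^-distribʳ-* : ∀ k a b → (a ℕ.* b) ℕ.^ k ≡ a ℕ.^ k ℕ.* b ℕ.^ k
^-distribʳ-* zero    a b = refl
^-distribʳ-* (suc k) a b = trans (cong (a ℕ.* b ℕ.*_) (^-distribʳ-* k a b))
  (interchange a b (a ℕ.^ k) (b ℕ.^ k))
  where
  interchange : ∀ a b x y → a ℕ.* b ℕ.* (x ℕ.* y) ≡ a ℕ.* x ℕ.* (b ℕ.* y)
  interchange = solve-∀

-- Since `c ≤ r`, a second factor `r` absorbs the constant: `E ≤ r * r * q`, and the `j`-th power of
-- `r * r` is at most `n`.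
power-bound : ∀ j {c r n q E} → c ℕ.≤ r → r ℕ.^ (j ℕ.+ j) ℕ.≤ n → E ℕ.≤ c ℕ.* r ℕ.* q →
              E ℕ.^ j ℕ.≤ n ℕ.* q ℕ.^ j
power-bound j {c} {r} {n} {q} {E} c≤r r²ʲ≤n E≤ = begin
  E ℕ.^ j                          ≤⟨ ℕ.^-monoˡ-≤ j E≤ ⟩
  (c ℕ.* r ℕ.* q) ℕ.^ j            ≡⟨ ^-distribʳ-* j (c ℕ.* r) q ⟩
  (c ℕ.* r) ℕ.^ j ℕ.* q ℕ.^ j      ≤⟨ ℕ.*-monoˡ-≤ (q ℕ.^ j) (ℕ.^-monoˡ-≤ j (ℕ.*-monoˡ-≤ r c≤r)) ⟩
  (r ℕ.* r) ℕ.^ j ℕ.* q ℕ.^ j      ≡⟨ cong (ℕ._* q ℕ.^ j) (^-distribʳ-* j r r) ⟩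
  r ℕ.^ j ℕ.* r ℕ.^ j ℕ.* q ℕ.^ j  ≡⟨ cong (ℕ._* q ℕ.^ j) (ℕ.^-distribˡ-+-* r j j) ⟨
  r ℕ.^ (j ℕ.+ j) ℕ.* q ℕ.^ j      ≤⟨ ℕ.*-monoˡ-≤ (q ℕ.^ j) r²ʲ≤n ⟩
  n ℕ.* q ℕ.^ j                    ∎
  where open ℕ.≤-Reasoning

module _ {ε : ℚ} (0<ε : 0ℚ < ε) (m : ℕ) where
  private
    j k : ℕ
    j = suc m
    -- This makes `suc k`, the number of levels, definitionally equal to `j + j`.
    k = m ℕ.+ suc m
    open Scale (scale 0<ε k)

    c : ℕ
    c = coefficient j (hops (suc K) k)

  -- From here on the integer root `r` of order `2j` satisfies `c ≤ r`.
  threshold : ℕ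
  threshold = c ℕ.^ (j ℕ.+ j)

  sparse-preserver : ∀ {n} (G : WeightedGraph n) P → threshold ℕ.≤ n →
    ∃[ H ] IsPreserver ε G P H × ∣E H ∣ ℕ.^ j ℕ.≤ n ℕ.* (n ℕ.+ length P) ℕ.^ j
  sparse-preserver {n} G P t≤n with floor-root k n
  ... | r , r≤n , n<r = preserver P , isPreserver P stretch≤ ,
      power-bound j c≤r r≤n (ℕ.≤-trans (preserver-size P)
        (size≤coefficient j (hops (suc K) k) n (length P) (ℕ.≤-trans (s≤s z≤n) c≤r)))
    where
    open Preserver G r k θ 0≤θ K K⋆θ≡1 28θ≤1 n<r
    c≤r : c ℕ.≤ r
    c≤r = ℕ.≮⇒≥ λ r<c → ℕ.<-irrefl refl
      (ℕ.<-≤-trans n<r (ℕ.≤-trans (ℕ.^-monoˡ-≤ (suc k) r<c) t≤n))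

-- An index growing as slowly as given thresholds demand

module _ (T : ℕ → ℕ) where
  private
    search : ℕ → ℕ → ℕ
    search n zero = 0
    search n (suc m) with T (suc m) ℕ.≤? n
    ... | yes _ = suc m
    ... | no  _ = search n m

    search-sound : ∀ n m → search n m ≡ 0 ⊎ T (search n m) ℕ.≤ n
    search-sound n zero = inj₁ refl
    search-sound n (suc m) with T (suc m) ℕ.≤? n
    ... | yes T≤n = inj₂ T≤n
    ... | no  _   = search-sound n m

    search-max : ∀ n m {i} → i ℕ.≤ m → T i ℕ.≤ n → i ℕ.≤ search n m
    search-max n zero    z≤n _ = z≤n
    search-max n (suc m) i≤m T≤n with T (suc m) ℕ.≤? n
    ... | yes _ = i≤m
    ... | no ≰n with ℕ.m≤n⇒m<n∨m≡n i≤m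
    ...   | inj₁ (s≤s i≤m′) = search-max n m i≤m′ T≤n
    ...   | inj₂ refl       = ⊥-elim (≰n T≤n)

  slow : ℕ → ℕ
  slow n = search n n

  slow-sound : ∀ n → slow n ≡ 0 ⊎ T (slow n) ℕ.≤ n
  slow-sound n = search-sound n n

  -- The summand `m` puts the index `m` within the range of the search, and `T m` makes it pass the
  -- test.
  slow-unbounded : ∀ m n → m ℕ.+ T m ℕ.≤ n → m ℕ.≤ slow n
  slow-unbounded m n le = search-max n n (ℕ.m+n≤o⇒m≤o m le) (ℕ.m+n≤o⇒n≤o m le)

1/suc<δ : ∀ {δ} → 0ℚ < δ → ∃[ b ] ∀ m → b ℕ.≤ m → ℚ.∣ 1/suc m ∣ < δ
1/suc<δ {mkℚ (pos zero) _ _}     (ℚ.*<* (ℤ.+<+ ()))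
-- The denominator of `δ` is `suc b`; taking `m ≥ suc b` makes `suc m` strictly larger, so
-- `1 / suc m < 1 / suc b ≤ δ`.
1/suc<δ {mkℚ (pos (suc a)) b _}    _ = suc b , λ m b<m → ℚ.*<* (ℤ.+<+ (begin-strict
  1 ℕ.* suc b      ≡⟨ ℕ.*-identityˡ (suc b) ⟩
  suc b            <⟨ s≤s b<m ⟩
  suc m            ≤⟨ ℕ.m≤m+n (suc m) (a ℕ.* suc m) ⟩
  suc a ℕ.* suc m  ∎))
  where open ℕ.≤-Reasoning
1/suc<δ {mkℚ (ℤ.-[1+ _ ]) _ _} (ℚ.*<* ())

theorem1p3 : ∀ (ε : ℚ) → 0ℚ < ε → ε < 1ℚ →
    ∀ (C : ℕ) →
    ∃[ o ] TendsToZero o ×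
    (∀ (n : ℕ) (G : WeightedGraph n) → WeightsAtMost (n ^ C) G →
    ∀ (P : List (Fin n × Fin n)) → Unique P →
    ∃[ H ] IsPreserver ε G P H × (∣E H ∣ ≤ n ^ o n · (n ℕ.+ length P)))
theorem1p3 ε 0<ε _ C = (λ n → 1/suc (level n)) , tendsToZero , λ n G _ P _ → bounded n G P
  where
  level : ℕ → ℕ
  level = slow (threshold 0<ε)

  tendsToZero : TendsToZero (λ n → 1/suc (level n))
  tendsToZero δ 0<δ = let b , small = 1/suc<δ 0<δ in
    b ℕ.+ threshold 0<ε b , λ n N≤n → small (level n) (slow-unbounded (threshold 0<ε) b n N≤n)

  bounded : ∀ n (G : WeightedGraph n) P →
    ∃[ H ] IsPreserver ε G P H × (∣E H ∣ ≤ n ^ 1/suc (level n) · (n ℕ.+ length P))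
  bounded n G P with level n | slow-sound (threshold 0<ε) n
  ... | l | inj₂ t≤n = let H , preserves , size = sparse-preserver 0<ε l G P t≤n in
    H , preserves , ℕ.≤-trans size (ℕ.≤-reflexive (cong (ℕ._* (n ℕ.+ length P) ^ suc l) (sym (ℕ.*-identityʳ n))))
  -- Index 0 means exponent 1, where the trivial bound `n * n` on the number of edges is enough.
  ... | .0 | inj₁ refl = G , isPreserver-refl G P (ℚ.<⇒≤ 0<ε) , (begin
    ∣E G ∣ ℕ.* 1                                ≡⟨ ℕ.*-identityʳ _ ⟩
    ∣E G ∣                                      ≤⟨ ∣E∣≤n*n G ⟩
    n ℕ.* n                                     ≤⟨ ℕ.*-monoʳ-≤ n (ℕ.m≤m+n n (length P)) ⟩
    n ℕ.* (n ℕ.+ length P)                      ≡⟨ cong₂ ℕ._*_ (ℕ.*-identityʳ n) (ℕ.*-identityʳ _) ⟨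
    n ℕ.* 1 ℕ.* ((n ℕ.+ length P) ℕ.* 1)        ∎)
    where open ℕ.≤-Reasoning
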